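{- Let $q$ be a power of an odd prime and write $N=q+1=2^mp_1^{e_1}\cdots p_s^{e_s}$, where $p_1,\dots,p_s$ are pairwise distinct odd primes and $m,e_1,\dots,e_s$ are positive integers. Define $$E_q(B,C)=\operatorname{lcm}\big(\mathcal V_{\frac{N}{2p_1}}(B,C),\dots,\mathcal V_{\frac{N}{2p_s}}(B,C)\big).$$ Let $f(X)=X^2+bX+c\in\mathbb F_q[X]$ be an irreducible quadratic polynomial, where $c$ is a primitive element of $\mathbb F_q$. Then $f(X)$ is primitive if and only if $E_q(b,c)\ne 0$.
   Context: A primitive element of $\mathbb F_q$ is a generator of $\mathbb F_q^*$. A monic quadratic polynomial over $\mathbb F_q$ is primitive if it is the minimal polynomial over $\mathbb F_q$ of a generator of $\mathbb F_{q^2}^*$. Let $B,C$ be algebraically independent indeterminates over $\mathbb F_q$. The Lucas polynomials of the second type are defined by $\mathcal V_0=2$, $\mathcal V_1=-B$, $\mathcal V_n=-B\,\mathcal V_{n-1}-C\,\mathcal V_{n-2}$ for $n\ge2$. The lcm is the least common multiple in $\mathbb F_q[B,C]$, normalized to be monic with respect to $B$; the empty lcm (case $s=0$) is $1$. -}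

module Defs where

open import Level using (Level; _⊔_)
open import Algebra.Bundles.Raw using (RawRing)
open import Algebra.Apartness.Bundles using (HeytingField; HeytingCommutativeRing)
open import Algebra.Bundles using (CommutativeRing)
import Algebra.Definitions.RawSemiring as RawSemiringDefinitions
open import Data.Fin.Base using (Fin)
open import Data.List.Base using (List; []; _∷_; map; foldr; tabulate)
open import Data.Nat.Base using (ℕ; zero; suc; _<_; _≤_; NonZero)
import Data.Nat.Base as ℕ
open import Data.Nat.Divisibility using (_∤_)
open import Data.Nat.DivMod using (_/_)
open import Data.Nat.ListAction using (product)
open import Data.Nat.Primality using (Prime; prime⇒nonZero)
open import Data.Nat.Properties using (m*n≢0)
open import Data.Product.Base using (_×_; ∃-syntax)
open import Function.Base using (id)
open import Function.Bundles using (Inverse)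
open import Function.Definitions using (Injective)
open import Relation.Binary.PropositionalEquality using (_≡_; setoid)
open import Relation.Nullary.Negation using (¬_)

private
  variable
    a b c ℓ ℓ₁ ℓ₂ : Level

------------------------------------------------------------------------
-- Arithmetic of q and q + 1

record OddPrimePower (q : ℕ) : Set where
  field
    r       : ℕ
    k       : ℕ
    r-prime : Prime r
    r-odd   : 2 ∤ r
    k>0     : 0 < k
    q≡r^k   : q ≡ r ℕ.^ k

-- N = 2^m · p₁^e₁ ⋯ pₛ^eₛ; s = 0 is allowed.
record EvenFactorisation (N : ℕ) : Set where
  field
    m          : ℕ
    s          : ℕ
    p          : Fin s → ℕ
    e          : Fin s → ℕ
    m>0        : 0 < m
    e>0        : ∀ i → 0 < e i
    p-prime    : ∀ i → Prime (p i)
    p-odd      : ∀ i → 2 ∤ p i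
    p-distinct : Injective _≡_ _≡_ p
    N≡         : N ≡ 2 ℕ.^ m ℕ.* product (tabulate (λ i → p i ℕ.^ e i))

  N/2p : Fin s → ℕ
  N/2p i = _/_ N (2 ℕ.* p i) {{2p≢0}}
    where
    2p≢0 : NonZero (2 ℕ.* p i)
    2p≢0 = m*n≢0 2 (p i) {{_}} {{prime⇒nonZero (p-prime i)}}

------------------------------------------------------------------------
-- Univariate polynomials

-- A polynomial is its list of coefficients, constant term first.
-- Trailing zeros are allowed, so equality compares all coefficients.
module _ (R : RawRing a ℓ) where

  open RawRing R

  coeff : List Carrier → ℕ → Carrier
  coeff []      n       = 0#
  coeff (x ∷ p) zero    = x
  coeff (x ∷ p) (suc n) = coeff p n

  addₚ : List Carrier → List Carrier → List Carrier
  addₚ []      q       = q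
  addₚ (x ∷ p) []      = x ∷ p
  addₚ (x ∷ p) (y ∷ q) = (x + y) ∷ addₚ p q

  mulₚ : List Carrier → List Carrier → List Carrier
  mulₚ []      q = []
  mulₚ (x ∷ p) q = addₚ (map (x *_) q) (0# ∷ mulₚ p q)

  Poly : RawRing a ℓ
  Poly = record
    { Carrier = List Carrier
    ; _≈_     = λ p q → ∀ n → coeff p n ≈ coeff q n
    ; _+_     = addₚ
    ; _*_     = mulₚ
    ; -_      = map (-_)
    ; 0#      = []
    ; 1#      = 1# ∷ []
    }

  const : Carrier → List Carrier
  const x = x ∷ []

  X : List Carrier
  X = 0# ∷ 1# ∷ []

  MonicOfDegree : ℕ → List Carrier → Set ℓ
  MonicOfDegree d p = coeff p d ≈ 1# × (∀ n → d < n → coeff p n ≈ 0#)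

  Monic : List Carrier → Set ℓ
  Monic p = ∃[ d ] MonicOfDegree d p

-- The value at x of the polynomial obtained by applying φ to each coefficient.
eval : {A : Set a} (S : RawRing b ℓ) → (A → RawRing.Carrier S) →
       List A → RawRing.Carrier S → RawRing.Carrier S
eval S φ p x = foldr (λ a r → φ a + x * r) 0# p
  where open RawRing S

------------------------------------------------------------------------
-- Bivariate polynomials and Lucas polynomials

module _ (R : RawRing a ℓ) where

  -- R[B,C] is represented as R[C][B], so that `Monic (Poly R)` means
  -- monic with respect to B.
  Poly₂ : RawRing a ℓ
  Poly₂ = Poly (Poly R)

  open RawRing Poly₂

  B C : Carrier
  B = X (Poly R)
  C = const (Poly R) (X R)

  eval₂ : Carrier → RawRing.Carrier R → RawRing.Carrier R → RawRing.Carrier R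
  eval₂ P b c = eval R (λ p → eval R id p c) P b

  𝒱 : ℕ → Carrier
  𝒱 0             = 1# + 1#
  𝒱 1             = - B
  𝒱 (suc (suc n)) = (- B) * 𝒱 (suc n) + (- (C * 𝒱 n))

------------------------------------------------------------------------
-- Least common multiples

record IsLCM (R : RawRing a ℓ) {s : ℕ} (v : Fin s → RawRing.Carrier R)
             (l : RawRing.Carrier R) : Set (a ⊔ ℓ) where
  open RawRing R
  open RawSemiringDefinitions rawSemiring using (_∣_)
  field
    multiple : ∀ i → v i ∣ l
    least    : ∀ {k} → (∀ i → v i ∣ k) → l ∣ k

-- Least common multiples are determined only up to units; E_q is the one
-- that is monic in B.
record IsE (R : RawRing a ℓ) {N : ℕ} (fac : EvenFactorisation N)
           (E : RawRing.Carrier (Poly₂ R)) : Set (a ⊔ ℓ) where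
  open EvenFactorisation fac
  field
    isLCM : IsLCM (Poly₂ R) (λ i → 𝒱 R (N/2p i)) E
    monic : Monic (Poly R) E

------------------------------------------------------------------------
-- Finite fields and their extensions

rawRing : HeytingField c ℓ₁ ℓ₂ → RawRing c ℓ₁
rawRing F = CommutativeRing.rawRing
  (HeytingCommutativeRing.commutativeRing (HeytingField.heytingCommutativeRing F))

-- Equality on a finite Heyting field is decidable, and so every element
-- that is not ≈ 0# is invertible: it is a finite field in the usual sense.
HasOrder : HeytingField c ℓ₁ ℓ₂ → ℕ → Set (c ⊔ ℓ₁)
HasOrder F n = Inverse
  (CommutativeRing.setoid
    (HeytingCommutativeRing.commutativeRing (HeytingField.heytingCommutativeRing F)))
  (setoid (Fin n))

-- g generates the multiplicative group of nonzero elements.  This is used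
-- for finite fields only, where g⁻¹ is itself a nonnegative power of g.
PrimitiveElement : (F : HeytingField c ℓ₁ ℓ₂) → HeytingField.Carrier F → Set (c ⊔ ℓ₁)
PrimitiveElement F g =
  ¬ (g ≈ 0#) × (∀ x → ¬ (x ≈ 0#) → ∃[ n ] (g ^ n) ≈ x)
  where
  open RawRing (rawRing F)
  open RawSemiringDefinitions rawSemiring using (_^_)

IrreduciblePoly : (F : HeytingField c ℓ₁ ℓ₂) → List (HeytingField.Carrier F) → Set (c ⊔ ℓ₁)
IrreduciblePoly F = RawSemiringDefinitions.Irreducible
  (RawRing.rawSemiring (Poly (rawRing F)))

quadratic : (F : HeytingField c ℓ₁ ℓ₂) (b c : HeytingField.Carrier F) →
            List (HeytingField.Carrier F)
quadratic F b c = c ∷ b ∷ HeytingField.1# F ∷ []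

module _ {c′ ℓ₁′ ℓ₂′} (F : HeytingField c ℓ₁ ℓ₂) (K : HeytingField c′ ℓ₁′ ℓ₂′)
         (ι : HeytingField.Carrier F → HeytingField.Carrier K) where

  private
    module K = HeytingField K

  record IsMinimalPolynomial (f : List (HeytingField.Carrier F)) (α : K.Carrier)
         : Set (c ⊔ ℓ₁ ⊔ ℓ₁′) where
    field
      degree  : ℕ
      monic   : MonicOfDegree (rawRing F) degree f
      root    : eval (rawRing K) ι f α K.≈ K.0#
      minimal : ∀ {d} g → MonicOfDegree (rawRing F) d g →
                eval (rawRing K) ι g α K.≈ K.0# → degree ≤ d

  -- For a monic quadratic f, with F of order q and K of order q².
  PrimitiveQuadratic : List (HeytingField.Carrier F) → Set (c ⊔ ℓ₁ ⊔ c′ ⊔ ℓ₁′)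
  PrimitiveQuadratic f = ∃[ α ] PrimitiveElement K α × IsMinimalPolynomial f α

-- Let α be a root of f in K, and u = α^(q-1).  Since q is odd, f is
-- determined by its discriminant, a nonsquare of F, and the Frobenius map
-- negates the square roots of nonsquares; hence α^q is the other root of f,
-- α^(q+1) = c and 𝒱ₙ(b,c) = αⁿ + α^(qn) = αⁿ (1 + uⁿ), so that 𝒱ₙ(b,c)
-- vanishes exactly when uⁿ = -1.  If this happens for n = N/2p, then
-- u^(N/p) = 1 and α is not a generator.  Conversely let αᵗ = 1.  Taking norms,
-- cᵗ = 1, so q-1 divides t, say t = (q-1)k, and uᵏ = 1.  As also u^N = 1, if k is
-- not a multiple of N then u^(N/p) = 1 for some prime p dividing N.  Now
-- u^(N/2) = c^((q-1)/2) = -1 excludes p = 2; for p odd it also excludes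
-- u^(N/2p) = 1, which leaves u^(N/2p) = -1, that is 𝒱_(N/2p)(b,c) = 0.
--
-- Such an α exists: if β lies in K but not in F, then by counting K = F + Fβ, so
-- β² = x + yβ and 2β - y is a square root of a nonsquare of F; the quotient of
-- two nonsquares of F is a square, so the discriminant of f has a root in K.
module Submission where

open import Defs
open import Algebra.Apartness.Bundles using (HeytingCommutativeRing; HeytingField)
open import Algebra.Bundles using (CommutativeRing)
open import Algebra.Bundles.Raw using (RawRing)
open import Algebra.Definitions.RawMagma using (_,_)
import Algebra.Definitions.RawSemiring as RawSemiringDefinitions
import Algebra.Morphism.Construct.Identity as Identity
open import Algebra.Morphism.Structures using (IsRingHomomorphism)
import Algebra.Properties.AbelianGroup as AbelianGroupProperties
import Algebra.Properties.CommutativeMonoid.Sum as CommutativeMonoidSum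
import Algebra.Properties.CommutativeSemigroup as CommutativeSemigroupProperties
import Algebra.Properties.CommutativeSemiring.Binomial as CommutativeSemiringBinomial
import Algebra.Properties.CommutativeSemiring.Exp as CommutativeSemiringExp
import Algebra.Properties.Group as GroupProperties
import Algebra.Properties.Ring as RingProperties
import Algebra.Properties.Semigroup.Divisibility as SemigroupDivisibility
import Algebra.Properties.Semiring.Mult as SemiringMult
import Algebra.Properties.Semiring.Mult.TCOptimised as TCMult
import Algebra.Solver.Ring as RingSolver
open import Algebra.Solver.Ring.AlmostCommutativeRing using (_-Raw-AlmostCommutative⟶_; fromCommutativeRing)
open import Data.Fin.Base as Fin using (Fin; zero; suc; toℕ; inject₁; fromℕ; combine; remQuot)
open import Data.Fin.Permutation using (permutation)
open import Data.Fin.Properties using (any?; ¬∀⟶∃¬; pigeonhole; injective⇒≤; combine-remQuot; toℕ<n; toℕ-inject₁; toℕ-fromℕ; fromℕ<-injective) renaming (_≟_ to _≟ᶠ_; suc-injective to sucᶠ-injective; <-irrefl to <ᶠ-irrefl)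
open import Data.Integer.Base as ℤ using (ℤ; +_; -[1+_])
import Data.Integer.Properties as ℤ
open import Data.List.Base using (List; []; _∷_; map; tabulate)
open import Data.List.Relation.Unary.All using (_∷_)
open import Data.Maybe.Base as Maybe using (Maybe)
open import Data.Nat.Base as ℕ using (ℕ; zero; suc; pred; _∸_; _≤_; _<_; _!; s≤s; s<s; z<s; NonZero)
open import Data.Nat.Combinatorics using (nCk≡n!/k![n-k]!; k![n∸k]!∣n!; nCn≡1; nCk≡nC[n∸k]) renaming (_C_ to infixl 8 _choose_)
open import Data.Nat.Divisibility using (_∣_; divides; ∣⇒≤; >⇒∤; ∣1⇒≡1; 0∣⇒≡0; ∣-trans; ∣m⇒∣m*n; ∣n⇒∣m*n; m∣m*n; *-pres-∣; *-monoˡ-∣; *-cancelˡ-∣)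
open import Data.Nat.DivMod using (_%_; _/_; m≡m%n+[m/n]*n; m%n<n; m/n*n≡m)
open import Data.Nat.GCD using (gcd; gcd-GCD; gcd[m,n]∣m; gcd[m,n]∣n; module Bézout)
open import Data.Nat.ListAction using (product)
open import Data.Nat.Primality using (Prime; prime[2]; ¬prime[0]; ¬prime[1]; prime⇒irreducible; prime⇒nonZero; prime⇒nonTrivial; euclidsLemma)
open import Data.Nat.Primality.Factorisation using (factorise)
import Data.Nat.Properties as ℕ
open import Data.Nat.Properties using (_!*_!≢0; m+[n∸m]≡n; suc-pred)
import Data.Nat.Tactic.RingSolver as ℕSolver
open import Data.Product.Base using (_×_; _,_; proj₁; proj₂; ∃-syntax)
open import Data.Sum.Base using (_⊎_; inj₁; inj₂)
open import Data.Vec.Functional using (replicate)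
open import Function.Base using (_∘_; id)
open import Function.Bundles using (Inverse; _⇔_; mk⇔)
open import Level using (Level)
open import Relation.Binary.Consequences using (dec⇒weaklyDec)
open import Relation.Binary.Definitions using (Decidable)
open import Relation.Binary.PropositionalEquality as ≡ using (_≡_)
import Relation.Binary.Reasoning.Setoid as SetoidReasoning
open import Relation.Nullary.Decidable using (Dec; yes; no; map′)
open import Relation.Nullary.Negation using (¬_; contradiction)

-- `K` is any field of order q^2 with a homomorphism from `F`, not a given quotient of F[X]. So a
-- root of f has to be produced inside it, and nothing is known beforehand about its multiplicative
-- group. The primitive element c makes up for this on the side of F: it supplies logarithms, hence
-- x^q = x, and it tells squares from nonsquares by the parity of an exponent. On the side of K,
-- group theory is replaced by counting: an element whose powers with exponent 0 < t < q^2 - 1 all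
-- differ from 1 has q^2 - 1 distinct powers, which must exhaust the nonzero elements. The Frobenius
-- map is additive because q^2 · 1 = 0 in K and q^2 is a power of the prime r. The prime p with
-- u^(N/p) = 1 comes from d = gcd(k, N): Bézout gives u^d = 1, and d < N leaves a prime p such that
-- pd still divides N.

private
  variable
    a b c c′ ℓ ℓ₁ ℓ₂ ℓ₁′ ℓ₂′ : Level

-- Arithmetic

even-or-odd : ∀ n → (∃[ k ] n ≡ k ℕ.+ k) ⊎ (∃[ k ] n ≡ suc (k ℕ.+ k))
even-or-odd zero    = inj₁ (0 , ≡.refl)
even-or-odd (suc n) with even-or-odd n
... | inj₁ (k , ≡.refl) = inj₂ (k , ≡.refl)
... | inj₂ (k , ≡.refl) = inj₁ (suc k , ≡.cong suc (≡.sym (ℕ.+-suc k k)))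

even-suc⇒odd : ∀ {n} → 2 ∣ suc n → ∃[ h ] n ≡ suc (h ℕ.+ h)
even-suc⇒odd {n} (divides (suc h) 1+n≡) = h , ≡.trans (≡.cong pred 1+n≡) (≡.cong suc (identity h))
  where
  identity : ∀ h → h ℕ.* 2 ≡ h ℕ.+ h
  identity = ℕSolver.solve-∀

n<n² : ∀ {n} → 1 < n → n < n ℕ.^ 2
n<n² {n} 1<n = ≡.subst (λ m → n < n ℕ.* m) (≡.sym (ℕ.*-identityʳ n))
  (ℕ.m<m*n n n {{ℕ.>-nonZero (ℕ.<-trans z<s 1<n)}} 1<n)

prime∣prime⇒≡ : ∀ {p r} → Prime p → Prime r → p ∣ r → p ≡ r
prime∣prime⇒≡ p-prime r-prime p∣r with prime⇒irreducible r-prime p∣r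
... | inj₁ ≡.refl = contradiction p-prime ¬prime[1]
... | inj₂ p≡r    = p≡r

prime∤1 : ∀ {p} → Prime p → ¬ p ∣ 1
prime∤1 p-prime p∣1 = ¬prime[1] (≡.subst Prime (∣1⇒≡1 p∣1) p-prime)

prime∣^⇒∣ : ∀ {p} → Prime p → ∀ x e → p ∣ x ℕ.^ e → p ∣ x
prime∣^⇒∣ p-prime x zero    p∣1  = contradiction p∣1 (prime∤1 p-prime)
prime∣^⇒∣ p-prime x (suc e) p∣xxᵉ with euclidsLemma x (x ℕ.^ e) p-prime p∣xxᵉ
... | inj₁ p∣x  = p∣x
... | inj₂ p∣xᵉ = prime∣^⇒∣ p-prime x e p∣xᵉ

∣product : ∀ {s} (f : Fin s → ℕ) i → f i ∣ product (tabulate f)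
∣product f zero    = m∣m*n _
∣product f (suc i) = ∣n⇒∣m*n (f zero) (∣product (f ∘ suc) i)

prime∣product⇒∣ : ∀ {p} → Prime p → ∀ {s} (f : Fin s → ℕ) → p ∣ product (tabulate f) → ∃[ i ] p ∣ f i
prime∣product⇒∣ p-prime {zero}  f p∣1 = contradiction p∣1 (prime∤1 p-prime)
prime∣product⇒∣ p-prime {suc s} f p∣Π with euclidsLemma (f zero) _ p-prime p∣Π
... | inj₁ p∣f₀ = zero , p∣f₀
... | inj₂ p∣Π′ with i , p∣fᵢ ← prime∣product⇒∣ p-prime (f ∘ suc) p∣Π′ = suc i , p∣fᵢ

prime∤! : ∀ {p} → Prime p → ∀ {k} → k < p → ¬ p ∣ k !
prime∤! p-prime {zero}  k<p p∣1 = prime∤1 p-prime p∣1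
prime∤! p-prime {suc k} k<p p∣k! with euclidsLemma (suc k) (k !) p-prime p∣k!
... | inj₁ p∣1+k = >⇒∤ k<p p∣1+k
... | inj₂ p∣k!′ = prime∤! p-prime (ℕ.<-trans (ℕ.n<1+n k) k<p) p∣k!′

-- p divides p! = (p choose k) · k! · (p - k)!, but neither factorial, both being products of
-- numbers below p. This is what makes the Frobenius map additive.
prime∣choose : ∀ {p} → Prime p → ∀ {k} → 0 < k → k < p → p ∣ p choose k
prime∣choose {p} p-prime {k} 0<k k<p with euclidsLemma (p choose k) (k ! ℕ.* (p ∸ k) !) p-prime p∣C*k![p-k]!
  where
  C*k![p-k]!≡p! : p choose k ℕ.* (k ! ℕ.* (p ∸ k) !) ≡ p !
  C*k![p-k]!≡p! = ≡.trans
    (≡.cong (ℕ._* (k ! ℕ.* (p ∸ k) !)) (nCk≡n!/k![n-k]! (ℕ.<⇒≤ k<p)))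
    (m/n*n≡m {{k !* (p ∸ k) !≢0}} (k![n∸k]!∣n! (ℕ.<⇒≤ k<p)))
  p∣p! : ∀ {m} → 0 < m → m ∣ m !
  p∣p! {suc m} _ = m∣m*n (m !)
  p∣C*k![p-k]! : p ∣ p choose k ℕ.* (k ! ℕ.* (p ∸ k) !)
  p∣C*k![p-k]! = ≡.subst (p ∣_) (≡.sym C*k![p-k]!≡p!) (p∣p! (ℕ.<-trans 0<k k<p))
... | inj₁ p∣C = p∣C
... | inj₂ p∣k![p-k]! with euclidsLemma (k !) ((p ∸ k) !) p-prime p∣k![p-k]!
...   | inj₁ p∣k!     = contradiction p∣k! (prime∤! p-prime k<p)
...   | inj₂ p∣[p-k]! = contradiction p∣[p-k]! (prime∤! p-prime (ℕ.∸-monoʳ-< 0<k (ℕ.<⇒≤ k<p)))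

prime-divisor : ∀ n → 1 < n → ∃[ p ] Prime p × p ∣ n
prime-divisor n@(suc _) 1<n with factorise n
... | record { factors = []    ; isFactorisation = n≡1 } = contradiction (≡.sym n≡1) (ℕ.<⇒≢ 1<n)
... | record { factors = p ∷ _ ; isFactorisation = n≡ ; factorsPrime = p-prime ∷ _ } =
  p , p-prime , ≡.subst (p ∣_) (≡.sym n≡) (m∣m*n _)

-- Any prime divisor p of the cofactor n/d will do. Applied to a proper divisor d of N with u^d = 1,
-- it gives u^(N/p) = 1.
properDivisor-prime-multiple : ∀ {d n} → d ∣ n → d < n → ∃[ p ] Prime p × p ℕ.* d ∣ n
properDivisor-prime-multiple {d} (divides k ≡.refl) d<kd
  with p , p-prime , p∣k ← prime-divisor k (ℕ.*-cancelʳ-< d 1 k (≡.subst (ℕ._< k ℕ.* d) (≡.sym (ℕ.*-identityˡ d)) d<kd))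
  = p , p-prime , *-monoˡ-∣ d p∣k

-- The prime divisors of N

module EvenFactorisationProperties {N : ℕ} (fac : EvenFactorisation N) where

  open EvenFactorisation fac

  2∣N : 2 ∣ N
  2∣N = ≡.subst (2 ∣_) (≡.sym N≡) (∣m⇒∣m*n _ (2∣2^ m>0))
    where
    2∣2^ : ∀ {k} → 0 < k → 2 ∣ 2 ℕ.^ k
    2∣2^ {suc k} _ = m∣m*n (2 ℕ.^ k)

  2p∣N : ∀ i → 2 ℕ.* p i ∣ N
  2p∣N i = ≡.subst (2 ℕ.* p i ∣_) (≡.sym N≡) (*-pres-∣ (x∣x^ 2 m>0) (∣-trans (x∣x^ (p i) (e>0 i)) (∣product (λ j → p j ℕ.^ e j) i)))
    where
    x∣x^ : ∀ x {k} → 0 < k → x ∣ x ℕ.^ k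
    x∣x^ x {suc k} _ = m∣m*n (x ℕ.^ k)

  -- The division defining `N/2p` truncates; it is exact here because 2 and `p i` divide separate
  -- factors of N, namely 2^m and the product of the odd prime powers.
  N/2p*2p≡N : ∀ i → N/2p i ℕ.* (2 ℕ.* p i) ≡ N
  N/2p*2p≡N i = m/n*n≡m {{ℕ.m*n≢0 2 (p i) {{_}} {{prime⇒nonZero (p-prime i)}}}} (2p∣N i)

  -- Completeness of the list of primes: every odd prime divisor of N contributes to the lcm,
  -- without which a nonzero value of E could not imply primitivity.
  primeDivisor-cases : ∀ {r} → Prime r → r ∣ N → r ≡ 2 ⊎ ∃[ i ] r ≡ p i
  primeDivisor-cases {r} r-prime r∣N with euclidsLemma (2 ℕ.^ m) _ r-prime (≡.subst (r ∣_) N≡ r∣N)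
  ... | inj₁ r∣2^m = inj₁ (prime∣prime⇒≡ r-prime prime[2] (prime∣^⇒∣ r-prime 2 m r∣2^m))
  ... | inj₂ r∣Π with i , r∣pᵢ^eᵢ ← prime∣product⇒∣ r-prime (λ j → p j ℕ.^ e j) r∣Π
    = inj₂ (i , prime∣prime⇒≡ r-prime (p-prime i) (prime∣^⇒∣ r-prime (p i) (e i) r∣pᵢ^eᵢ))

-- Ring solver with integer coefficients

-- The library's solvers take coefficients in the ring itself, where equality
-- does not compute and cancelling terms are not recognised.

module IntegerCoefficientSolver (R : CommutativeRing a ℓ) where

  open CommutativeRing R
  open TCMult semiring using (×-homo-+; ×1-homo-*; 1+×) renaming (_×_ to _ו_)
  open RingProperties ring using (-0#≈0#; -‿involutive; -‿distribˡ-*; -‿distribʳ-*)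
  open AbelianGroupProperties +-abelianGroup using (⁻¹-∙-comm)
  open SetoidReasoning setoid

  private
    fromℤ : ℤ → Carrier
    fromℤ (+ n)    = n ו 1#
    fromℤ -[1+ n ] = - (suc n ו 1#)

    cancel : ∀ x y z → (x + y) - (x + z) ≈ y - z
    cancel x y z = begin
      (x + y) - (x + z)       ≈⟨ +-congˡ (⁻¹-∙-comm x z) ⟨
      (x + y) + (- x + - z)   ≈⟨ +-congʳ (+-comm x y) ⟩
      (y + x) + (- x + - z)   ≈⟨ +-assoc y x _ ⟩
      y + (x + (- x + - z))   ≈⟨ +-congˡ (+-assoc x (- x) (- z)) ⟨
      y + ((x - x) + - z)     ≈⟨ +-congˡ (+-congʳ (-‿inverseʳ x)) ⟩
      y + (0# + - z)          ≈⟨ +-congˡ (+-identityˡ _) ⟩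
      y - z                   ∎

    fromℤ-⊖ : ∀ m n → fromℤ (m ℤ.⊖ n) ≈ m ו 1# - n ו 1#
    fromℤ-⊖ zero    zero    = sym (-‿inverseʳ 0#)
    fromℤ-⊖ zero    (suc n) = sym (+-identityˡ _)
    fromℤ-⊖ (suc m) zero    = sym (trans (+-congˡ -0#≈0#) (+-identityʳ _))
    fromℤ-⊖ (suc m) (suc n) = begin
      fromℤ (suc m ℤ.⊖ suc n)            ≡⟨ ≡.cong fromℤ (ℤ.[1+m]⊖[1+n]≡m⊖n m n) ⟩
      fromℤ (m ℤ.⊖ n)                    ≈⟨ fromℤ-⊖ m n ⟩
      m ו 1# - n ו 1#                    ≈⟨ cancel 1# _ _ ⟨
      (1# + m ו 1#) - (1# + n ו 1#)      ≈⟨ +-cong (1+× m 1#) (-‿cong (1+× n 1#)) ⟨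
      suc m ו 1# - suc n ו 1#            ∎

    fromℤ-+ : ∀ i j → fromℤ (i ℤ.+ j) ≈ fromℤ i + fromℤ j
    fromℤ-+ (+ m)    (+ n)    = ×-homo-+ 1# m n
    fromℤ-+ (+ m)    -[1+ n ] = fromℤ-⊖ m (suc n)
    fromℤ-+ -[1+ m ] (+ n)    = trans (fromℤ-⊖ n (suc m)) (+-comm _ _)
    fromℤ-+ -[1+ m ] -[1+ n ] = begin
      - (suc (suc (m ℕ.+ n)) ו 1#)    ≡⟨ ≡.cong (λ k → - (suc k ו 1#)) (≡.sym (ℕ.+-suc m n)) ⟩
      - ((suc m ℕ.+ suc n) ו 1#)      ≈⟨ -‿cong (×-homo-+ 1# (suc m) (suc n)) ⟩
      - (suc m ו 1# + suc n ו 1#)     ≈⟨ ⁻¹-∙-comm _ _ ⟨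
      - (suc m ו 1#) - (suc n ו 1#)   ∎

    fromℤ-neg : ∀ i → fromℤ (ℤ.- i) ≈ - fromℤ i
    fromℤ-neg (+ zero)  = sym -0#≈0#
    fromℤ-neg (+ suc n) = refl
    fromℤ-neg -[1+ n ]  = sym (-‿involutive _)

    fromℤ-+* : ∀ m j → fromℤ (+ m ℤ.* j) ≈ m ו 1# * fromℤ j
    fromℤ-+* m (+ n) = begin
      fromℤ (+ m ℤ.* + n)     ≡⟨ ≡.cong fromℤ (≡.sym (ℤ.pos-* m n)) ⟩
      (m ℕ.* n) ו 1#          ≈⟨ ×1-homo-* m n ⟩
      m ו 1# * n ו 1#         ∎
    fromℤ-+* m -[1+ n ] = begin
      fromℤ (+ m ℤ.* -[1+ n ])           ≡⟨ ≡.cong fromℤ (≡.sym (ℤ.neg-distribʳ-* (+ m) (+ suc n))) ⟩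
      fromℤ (ℤ.- (+ m ℤ.* + suc n))      ≈⟨ fromℤ-neg (+ m ℤ.* + suc n) ⟩
      - fromℤ (+ m ℤ.* + suc n)          ≈⟨ -‿cong (fromℤ-+* m (+ suc n)) ⟩
      - (m ו 1# * suc n ו 1#)            ≈⟨ -‿distribʳ-* _ _ ⟩
      m ו 1# * - (suc n ו 1#)            ∎

    fromℤ-* : ∀ i j → fromℤ (i ℤ.* j) ≈ fromℤ i * fromℤ j
    fromℤ-* (+ m)    j = fromℤ-+* m j
    fromℤ-* -[1+ m ] j = begin
      fromℤ (-[1+ m ] ℤ.* j)             ≡⟨ ≡.cong fromℤ (≡.sym (ℤ.neg-distribˡ-* (+ suc m) j)) ⟩
      fromℤ (ℤ.- (+ suc m ℤ.* j))        ≈⟨ fromℤ-neg (+ suc m ℤ.* j) ⟩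
      - fromℤ (+ suc m ℤ.* j)            ≈⟨ -‿cong (fromℤ-+* (suc m) j) ⟩
      - (suc m ו 1# * fromℤ j)           ≈⟨ -‿distribˡ-* _ _ ⟩
      - (suc m ו 1#) * fromℤ j           ∎

    morphism : ℤ.+-*-rawRing -Raw-AlmostCommutative⟶ fromCommutativeRing R
    morphism = record
      { ⟦_⟧    = fromℤ
      ; +-homo = fromℤ-+
      ; *-homo = fromℤ-*
      ; -‿homo = fromℤ-neg
      ; 0-homo = refl
      ; 1-homo = refl
      }

    coeff≟ : ∀ i j → Maybe (fromℤ i ≈ fromℤ j)
    coeff≟ i j = Maybe.map (λ i≡j → reflexive (≡.cong fromℤ i≡j)) (dec⇒weaklyDec ℤ._≟_ i j)

  open RingSolver ℤ.+-*-rawRing (fromCommutativeRing R) morphism coeff≟ public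
    using (Polynomial; solve; con; _:+_; _:*_; _:-_; :-_; _:=_)

-- Polynomials and their evaluation

module PolynomialRing (R : CommutativeRing a ℓ) where

  open CommutativeRing R renaming (rawRing to raw)
  open RingProperties ring using (-0#≈0#)
  private
    module +-CS = CommutativeSemigroupProperties +-commutativeSemigroup
    open SetoidReasoning setoid

    P : Set a
    P = List Carrier

    infix 4 _≋_
    _≋_ : P → P → Set ℓ
    p ≋ q = ∀ n → coeff raw p n ≈ coeff raw q n

    infixl 9 _at_
    _at_ : P → ℕ → Carrier
    _at_ = coeff raw

    infixl 7 _·_
    _·_ _⊕_ : P → P → P
    _·_ = mulₚ raw
    infixl 6 _⊕_
    _⊕_ = addₚ raw

    scale : Carrier → P → P
    scale x = map (x *_)

    at-⊕ : ∀ p q n → (p ⊕ q) at n ≈ p at n + q at n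
    at-⊕ []      q       n       = sym (+-identityˡ _)
    at-⊕ (x ∷ p) []      n       = sym (+-identityʳ _)
    at-⊕ (x ∷ p) (y ∷ q) zero    = refl
    at-⊕ (x ∷ p) (y ∷ q) (suc n) = at-⊕ p q n

    at-scale : ∀ x p n → scale x p at n ≈ x * p at n
    at-scale x []      n       = sym (zeroʳ x)
    at-scale x (y ∷ p) zero    = refl
    at-scale x (y ∷ p) (suc n) = at-scale x p n

    at-neg : ∀ p n → map (-_) p at n ≈ - (p at n)
    at-neg []      n       = sym -0#≈0#
    at-neg (y ∷ p) zero    = refl
    at-neg (y ∷ p) (suc n) = at-neg p n

    shift-cong : ∀ p q → p ≋ q → 0# ∷ p ≋ 0# ∷ q
    shift-cong p q p≋q zero    = refl
    shift-cong p q p≋q (suc n) = p≋q n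

    shift-zero : ∀ p → p ≋ [] → 0# ∷ p ≋ []
    shift-zero p p≋[] zero    = refl
    shift-zero p p≋[] (suc n) = p≋[] n

    at-shift-⊕ : ∀ p q n → (0# ∷ (p ⊕ q)) at n ≈ (0# ∷ p) at n + (0# ∷ q) at n
    at-shift-⊕ p q zero    = sym (+-identityˡ 0#)
    at-shift-⊕ p q (suc n) = at-⊕ p q n

    at-shift-scale : ∀ x p n → (0# ∷ scale x p) at n ≈ x * (0# ∷ p) at n
    at-shift-scale x p zero    = sym (zeroʳ x)
    at-shift-scale x p (suc n) = at-scale x p n

    -- The recursion (x + X p) q = x q + X (p q), with `0# ∷ p` in the role of X p. Equality ignores
    -- trailing zeros, so ring laws are proved on coefficients, and those of multiplication come
    -- down to this rule.
    at-·-∷ˡ : ∀ x p q n → ((x ∷ p) · q) at n ≈ x * q at n + (0# ∷ p · q) at n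
    at-·-∷ˡ x p q n = trans (at-⊕ (scale x q) (0# ∷ p · q) n) (+-congʳ (at-scale x q n))

    ·-congˡ : ∀ p q q′ → q ≋ q′ → p · q ≋ p · q′
    ·-congˡ []      q q′ q≋q′ n = refl
    ·-congˡ (x ∷ p) q q′ q≋q′ n = begin
      ((x ∷ p) · q) at n                   ≈⟨ at-·-∷ˡ x p q n ⟩
      x * q at n + (0# ∷ p · q) at n
        ≈⟨ +-cong (*-congˡ (q≋q′ n)) (shift-cong (p · q) (p · q′) (·-congˡ p q q′ q≋q′) n) ⟩
      x * q′ at n + (0# ∷ p · q′) at n     ≈⟨ at-·-∷ˡ x p q′ n ⟨
      ((x ∷ p) · q′) at n                  ∎

    -- The mirror image of `at-·-∷ˡ`, unfolding the second factor; commutativity results from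
    -- comparing the two.
    ·-∷ʳ : ∀ q x p n → (q · (x ∷ p)) at n ≈ x * q at n + (0# ∷ q · p) at n
    ·-∷ʳ []      x p n = sym (trans (+-cong (zeroʳ x) (shift-zero [] (λ _ → refl) n)) (+-identityˡ 0#))
    ·-∷ʳ (y ∷ q) x p zero    = +-congʳ (*-comm y x)
    ·-∷ʳ (y ∷ q) x p (suc n) = begin
      (scale y p ⊕ q · (x ∷ p)) at n                    ≈⟨ at-⊕ (scale y p) (q · (x ∷ p)) n ⟩
      scale y p at n + (q · (x ∷ p)) at n               ≈⟨ +-cong (at-scale y p n) (·-∷ʳ q x p n) ⟩
      y * p at n + (x * q at n + (0# ∷ q · p) at n)     ≈⟨ +-CS.x∙yz≈y∙xz _ _ _ ⟩
      x * q at n + (y * p at n + (0# ∷ q · p) at n)     ≈⟨ +-congˡ (at-·-∷ˡ y q p n) ⟨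
      x * q at n + ((y ∷ q) · p) at n                   ∎

    ·-zeroʳ : ∀ p → p · [] ≋ []
    ·-zeroʳ []      n = refl
    ·-zeroʳ (x ∷ p) n = shift-zero (p · []) (·-zeroʳ p) n

    ·-comm : ∀ p q → p · q ≋ q · p
    ·-comm []      q n = sym (·-zeroʳ q n)
    ·-comm (x ∷ p) q n = begin
      ((x ∷ p) · q) at n                 ≈⟨ at-·-∷ˡ x p q n ⟩
      x * q at n + (0# ∷ p · q) at n     ≈⟨ +-congˡ (shift-cong (p · q) (q · p) (·-comm p q) n) ⟩
      x * q at n + (0# ∷ q · p) at n     ≈⟨ ·-∷ʳ q x p n ⟨
      (q · (x ∷ p)) at n                 ∎

    -- Equal polynomials may be lists of different lengths, which obstructs an induction along
    -- `p ≋ p′`. Commutativity moves the change to the second factor, where the induction runs on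
    -- the fixed list.
    ·-congʳ : ∀ p p′ q → p ≋ p′ → p · q ≋ p′ · q
    ·-congʳ p p′ q p≋p′ n = trans (·-comm p q n) (trans (·-congˡ q p p′ p≋p′ n) (·-comm q p′ n))

    ·-distribʳ : ∀ q p p′ → (p ⊕ p′) · q ≋ p · q ⊕ p′ · q
    ·-distribʳ q []      p′       n = refl
    ·-distribʳ q (x ∷ p) []       n = sym (trans (at-⊕ ((x ∷ p) · q) [] n) (+-identityʳ _))
    ·-distribʳ q (x ∷ p) (y ∷ p′) n = begin
      ((x + y ∷ (p ⊕ p′)) · q) at n                        ≈⟨ at-·-∷ˡ (x + y) (p ⊕ p′) q n ⟩
      (x + y) * q at n + (0# ∷ (p ⊕ p′) · q) at n
        ≈⟨ +-cong (distribʳ _ x y) (shift-cong ((p ⊕ p′) · q) (p · q ⊕ p′ · q) (·-distribʳ q p p′) n) ⟩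
      x * q at n + y * q at n + (0# ∷ (p · q ⊕ p′ · q)) at n  ≈⟨ +-congˡ (at-shift-⊕ (p · q) (p′ · q) n) ⟩
      x * q at n + y * q at n + ((0# ∷ p · q) at n + (0# ∷ p′ · q) at n)  ≈⟨ +-CS.interchange _ _ _ _ ⟩
      x * q at n + (0# ∷ p · q) at n + (y * q at n + (0# ∷ p′ · q) at n)
        ≈⟨ +-cong (at-·-∷ˡ x p q n) (at-·-∷ˡ y p′ q n) ⟨
      ((x ∷ p) · q) at n + ((y ∷ p′) · q) at n             ≈⟨ at-⊕ ((x ∷ p) · q) ((y ∷ p′) · q) n ⟨
      ((x ∷ p) · q ⊕ (y ∷ p′) · q) at n                    ∎

    ·-distribˡ : ∀ q p p′ → q · (p ⊕ p′) ≋ q · p ⊕ q · p′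
    ·-distribˡ q p p′ n = begin
      (q · (p ⊕ p′)) at n             ≈⟨ ·-comm q (p ⊕ p′) n ⟩
      ((p ⊕ p′) · q) at n             ≈⟨ ·-distribʳ q p p′ n ⟩
      (p · q ⊕ p′ · q) at n           ≈⟨ at-⊕ (p · q) (p′ · q) n ⟩
      (p · q) at n + (p′ · q) at n    ≈⟨ +-cong (·-comm p q n) (·-comm p′ q n) ⟩
      (q · p) at n + (q · p′) at n    ≈⟨ at-⊕ (q · p) (q · p′) n ⟨
      (q · p ⊕ q · p′) at n           ∎

    scale-· : ∀ x p q → scale x p · q ≋ scale x (p · q)
    scale-· x []      q n = refl
    scale-· x (y ∷ p) q n = begin
      ((x * y ∷ scale x p) · q) at n                     ≈⟨ at-·-∷ˡ (x * y) (scale x p) q n ⟩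
      x * y * q at n + (0# ∷ scale x p · q) at n
        ≈⟨ +-cong (*-assoc x y _) (shift-cong (scale x p · q) (scale x (p · q)) (scale-· x p q) n) ⟩
      x * (y * q at n) + (0# ∷ scale x (p · q)) at n     ≈⟨ +-congˡ (at-shift-scale x (p · q) n) ⟩
      x * (y * q at n) + x * (0# ∷ p · q) at n           ≈⟨ distribˡ x _ _ ⟨
      x * (y * q at n + (0# ∷ p · q) at n)               ≈⟨ *-congˡ (at-·-∷ˡ y p q n) ⟨
      x * ((y ∷ p) · q) at n                             ≈⟨ at-scale x ((y ∷ p) · q) n ⟨
      scale x ((y ∷ p) · q) at n                         ∎

    shift-· : ∀ p q → (0# ∷ p) · q ≋ 0# ∷ p · q
    shift-· p q n = trans (at-·-∷ˡ 0# p q n) (trans (+-congʳ (zeroˡ _)) (+-identityˡ _))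

    ·-assoc : ∀ p q r → p · q · r ≋ p · (q · r)
    ·-assoc []      q r n = refl
    ·-assoc (x ∷ p) q r n = begin
      ((scale x q ⊕ (0# ∷ p · q)) · r) at n                  ≈⟨ ·-distribʳ r (scale x q) (0# ∷ p · q) n ⟩
      (scale x q · r ⊕ (0# ∷ p · q) · r) at n                ≈⟨ at-⊕ (scale x q · r) ((0# ∷ p · q) · r) n ⟩
      (scale x q · r) at n + ((0# ∷ p · q) · r) at n
        ≈⟨ +-cong (scale-· x q r n) (shift-· (p · q) r n) ⟩
      scale x (q · r) at n + (0# ∷ p · q · r) at n
        ≈⟨ +-cong (at-scale x (q · r) n) (shift-cong (p · q · r) (p · (q · r)) (·-assoc p q r) n) ⟩
      x * (q · r) at n + (0# ∷ p · (q · r)) at n             ≈⟨ at-·-∷ˡ x p (q · r) n ⟨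
      ((x ∷ p) · (q · r)) at n                               ∎

    ·-identityˡ : ∀ p → (1# ∷ []) · p ≋ p
    ·-identityˡ p n = begin
      ((1# ∷ []) · p) at n              ≈⟨ at-·-∷ˡ 1# [] p n ⟩
      1# * p at n + (0# ∷ []) at n      ≈⟨ +-cong (*-identityˡ _) (shift-zero [] (λ _ → refl) n) ⟩
      p at n + 0#                       ≈⟨ +-identityʳ _ ⟩
      p at n                            ∎

    ⊕-cong : ∀ p p′ q q′ → p ≋ p′ → q ≋ q′ → p ⊕ q ≋ p′ ⊕ q′
    ⊕-cong p p′ q q′ p≋p′ q≋q′ n =
      trans (at-⊕ p q n) (trans (+-cong (p≋p′ n) (q≋q′ n)) (sym (at-⊕ p′ q′ n)))

    ⊕-comm : ∀ p q → p ⊕ q ≋ q ⊕ p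
    ⊕-comm p q n = trans (at-⊕ p q n) (trans (+-comm _ _) (sym (at-⊕ q p n)))

    ⊕-assoc : ∀ p q r → p ⊕ q ⊕ r ≋ p ⊕ (q ⊕ r)
    ⊕-assoc p q r n = begin
      (p ⊕ q ⊕ r) at n             ≈⟨ at-⊕ (p ⊕ q) r n ⟩
      (p ⊕ q) at n + r at n        ≈⟨ +-congʳ (at-⊕ p q n) ⟩
      p at n + q at n + r at n     ≈⟨ +-assoc _ _ _ ⟩
      p at n + (q at n + r at n)   ≈⟨ +-congˡ (at-⊕ q r n) ⟨
      p at n + (q ⊕ r) at n        ≈⟨ at-⊕ p (q ⊕ r) n ⟨
      (p ⊕ (q ⊕ r)) at n           ∎

    ⊕-inverseʳ : ∀ p → p ⊕ map (-_) p ≋ []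
    ⊕-inverseʳ p n = trans (at-⊕ p (map (-_) p) n) (trans (+-congˡ (at-neg p n)) (-‿inverseʳ _))

  polynomialRing : CommutativeRing a ℓ
  polynomialRing = record
    { Carrier = P
    ; _≈_     = _≋_
    ; _+_     = _⊕_
    ; _*_     = _·_
    ; -_      = map (-_)
    ; 0#      = []
    ; 1#      = 1# ∷ []
    ; isCommutativeRing = record
      { isRing = record
        { +-isAbelianGroup = record
          { isGroup = record
            { isMonoid = record
              { isSemigroup = record
                { isMagma = record
                  { isEquivalence = record
                    { refl  = λ n → refl
                    ; sym   = λ p≋q n → sym (p≋q n)
                    ; trans = λ p≋q q≋r n → trans (p≋q n) (q≋r n)
                    }
                  ; ∙-cong = λ {p} {p′} {q} {q′} → ⊕-cong p p′ q q′
                  }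
                ; assoc = ⊕-assoc
                }
              ; identity = (λ p n → refl) , (λ p n → trans (at-⊕ p [] n) (+-identityʳ _))
              }
            ; inverse = (λ p n → trans (⊕-comm (map (-_) p) p n) (⊕-inverseʳ p n)) , ⊕-inverseʳ
            ; ⁻¹-cong = λ {p} {q} p≋q n → trans (at-neg p n) (trans (-‿cong (p≋q n)) (sym (at-neg q n)))
            }
          ; comm = ⊕-comm
          }
        ; *-cong = λ {p} {p′} {q} {q′} p≋p′ q≋q′ n →
            trans (·-congʳ p p′ q p≋p′ n) (·-congˡ p′ q q′ q≋q′ n)
        ; *-assoc = ·-assoc
        ; *-identity = ·-identityˡ , (λ p n → trans (·-comm p (1# ∷ []) n) (·-identityˡ p n))
        ; distrib = ·-distribˡ , ·-distribʳ
        }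
      ; *-comm = ·-comm
      }
    }

open PolynomialRing public using (polynomialRing)

-- The coefficient map is arbitrary because three kinds are needed: the identity, the evaluation at
-- C = c when B is evaluated next, and `ι` for values in K.
module Evaluation (S : CommutativeRing a ℓ) (R : CommutativeRing b ℓ₁)
  {φ : CommutativeRing.Carrier S → CommutativeRing.Carrier R}
  (φ-hom : IsRingHomomorphism (CommutativeRing.rawRing S) (CommutativeRing.rawRing R) φ)
  (x : CommutativeRing.Carrier R) where

  open CommutativeRing R renaming (rawRing to raw)
  open RingProperties ring using (-0#≈0#)
  open IsRingHomomorphism φ-hom
  open IntegerCoefficientSolver R
  private
    module S = CommutativeRing S
    open SetoidReasoning setoid

    ev : List S.Carrier → Carrier
    ev p = eval raw φ p x

    -- Serves `ev-cong` when one list ends before the other: the surplus entries are all zero.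
    ev-zero : ∀ p → (∀ n → coeff S.rawRing p n S.≈ S.0#) → ev p ≈ 0#
    ev-zero []      p≋[] = refl
    ev-zero (s ∷ p) p≋[] = begin
      φ s + x * ev p
        ≈⟨ +-cong (trans (⟦⟧-cong (p≋[] 0)) 0#-homo) (*-congˡ (ev-zero p (λ n → p≋[] (suc n)))) ⟩
      0# + x * 0#      ≈⟨ +-identityˡ _ ⟩
      x * 0#           ≈⟨ zeroʳ x ⟩
      0#               ∎

    ev-cong : ∀ p q → (∀ n → coeff S.rawRing p n S.≈ coeff S.rawRing q n) → ev p ≈ ev q
    ev-cong []      q       p≋q = sym (ev-zero q (λ n → S.sym (p≋q n)))
    ev-cong (s ∷ p) []      p≋q = ev-zero (s ∷ p) p≋q
    ev-cong (s ∷ p) (t ∷ q) p≋q = +-cong (⟦⟧-cong (p≋q 0)) (*-congˡ (ev-cong p q (λ n → p≋q (suc n))))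

    ev-+ : ∀ p q → ev (addₚ S.rawRing p q) ≈ ev p + ev q
    ev-+ []      q       = sym (+-identityˡ _)
    ev-+ (s ∷ p) []      = sym (+-identityʳ _)
    ev-+ (s ∷ p) (t ∷ q) = begin
      φ (s S.+ t) + x * ev (addₚ S.rawRing p q)   ≈⟨ +-cong (+-homo s t) (*-congˡ (ev-+ p q)) ⟩
      φ s + φ t + x * (ev p + ev q)
        ≈⟨ solve 5 (λ u v x p q → u :+ v :+ x :* (p :+ q) := u :+ x :* p :+ (v :+ x :* q)) refl (φ s) (φ t) x (ev p) (ev q) ⟩
      φ s + x * ev p + (φ t + x * ev q)           ∎

    ev-scale : ∀ s p → ev (map (s S.*_) p) ≈ φ s * ev p
    ev-scale s []      = sym (zeroʳ _)
    ev-scale s (t ∷ p) = begin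
      φ (s S.* t) + x * ev (map (s S.*_) p)   ≈⟨ +-cong (*-homo s t) (*-congˡ (ev-scale s p)) ⟩
      φ s * φ t + x * (φ s * ev p)
        ≈⟨ solve 4 (λ u v x p → u :* v :+ x :* (u :* p) := u :* (v :+ x :* p)) refl (φ s) (φ t) x (ev p) ⟩
      φ s * (φ t + x * ev p)                  ∎

    ev-* : ∀ p q → ev (mulₚ S.rawRing p q) ≈ ev p * ev q
    ev-* []      q = sym (zeroˡ _)
    ev-* (s ∷ p) q = begin
      ev (addₚ S.rawRing (map (s S.*_) q) (S.0# ∷ mulₚ S.rawRing p q))
        ≈⟨ ev-+ (map (s S.*_) q) (S.0# ∷ mulₚ S.rawRing p q) ⟩
      ev (map (s S.*_) q) + (φ S.0# + x * ev (mulₚ S.rawRing p q))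
        ≈⟨ +-cong (ev-scale s q) (+-cong 0#-homo (*-congˡ (ev-* p q))) ⟩
      φ s * ev q + (0# + x * (ev p * ev q))
        ≈⟨ solve 4 (λ u x p q → u :* q :+ (con (+ 0) :+ x :* (p :* q)) := (u :+ x :* p) :* q) refl (φ s) x (ev p) (ev q) ⟩
      (φ s + x * ev p) * ev q                                            ∎

    ev-neg : ∀ p → ev (map S.-_ p) ≈ - ev p
    ev-neg []      = sym -0#≈0#
    ev-neg (s ∷ p) = begin
      φ (S.- s) + x * ev (map S.-_ p)   ≈⟨ +-cong (-‿homo s) (*-congˡ (ev-neg p)) ⟩
      - φ s + x * (- ev p)
        ≈⟨ solve 3 (λ u x p → :- u :+ x :* (:- p) := :- (u :+ x :* p)) refl (φ s) x (ev p) ⟩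
      - (φ s + x * ev p)                ∎

  eval-isRingHomomorphism :
    IsRingHomomorphism (CommutativeRing.rawRing (polynomialRing S)) raw (λ p → eval raw φ p x)
  eval-isRingHomomorphism = record
    { isSemiringHomomorphism = record
      { isNearSemiringHomomorphism = record
        { +-isMonoidHomomorphism = record
          { isMagmaHomomorphism = record
            { isRelHomomorphism = record { cong = λ {p} {q} → ev-cong p q }
            ; homo = ev-+
            }
          ; ε-homo = refl
          }
        ; *-homo = ev-*
        }
      ; 1#-homo = trans (+-cong 1#-homo (zeroʳ x)) (+-identityʳ 1#)
      }
    ; -‿homo = ev-neg
    }

  eval-X : eval raw φ (X S.rawRing) x ≈ x
  eval-X = begin
    φ S.0# + x * (φ S.1# + x * 0#)   ≈⟨ +-cong 0#-homo (*-congˡ (+-congʳ 1#-homo)) ⟩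
    0# + x * (1# + x * 0#)
      ≈⟨ solve 1 (λ x → con (+ 0) :+ x :* (con (+ 1) :+ x :* con (+ 0)) := x) refl x ⟩
    x                                ∎

  eval-const : ∀ s → eval raw φ (const S.rawRing s) x ≈ φ s
  eval-const s = trans (+-congˡ (zeroʳ x)) (+-identityʳ _)

-- Lucas polynomials at a point (b, c)

module BivariateEvaluation (R : CommutativeRing a ℓ) (b c : CommutativeRing.Carrier R) where

  open CommutativeRing R renaming (rawRing to raw)
  private
    R[C] R[B,C] : CommutativeRing a ℓ
    R[C] = polynomialRing R
    R[B,C] = polynomialRing R[C]

    module C-eval = Evaluation R R (Identity.isRingHomomorphism raw refl) c
    module B-eval = Evaluation R[C] R C-eval.eval-isRingHomomorphism b

  eval₂-isRingHomomorphism : IsRingHomomorphism (Poly₂ raw) raw (λ P → eval₂ raw P b c)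
  eval₂-isRingHomomorphism = B-eval.eval-isRingHomomorphism

  open IsRingHomomorphism eval₂-isRingHomomorphism

  eval₂-B : eval₂ raw (B raw) b c ≈ b
  eval₂-B = B-eval.eval-X

  eval₂-C : eval₂ raw (C raw) b c ≈ c
  eval₂-C = trans (B-eval.eval-const (X raw)) C-eval.eval-X

  eval₂-𝒱-0 : eval₂ raw (𝒱 raw 0) b c ≈ 1# + 1#
  eval₂-𝒱-0 = trans (+-homo 1ₚ 1ₚ) (+-cong 1#-homo 1#-homo)
    where 1ₚ = CommutativeRing.1# R[B,C]

  eval₂-𝒱-1 : eval₂ raw (𝒱 raw 1) b c ≈ - b
  eval₂-𝒱-1 = trans (-‿homo (B raw)) (-‿cong eval₂-B)

  eval₂-𝒱-suc-suc : ∀ n → eval₂ raw (𝒱 raw (suc (suc n))) b c ≈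
    (- b) * eval₂ raw (𝒱 raw (suc n)) b c + - (c * eval₂ raw (𝒱 raw n) b c)
  eval₂-𝒱-suc-suc n = trans (+-homo (-B P.* 𝒱 raw (suc n)) (P.- (C raw P.* 𝒱 raw n))) (+-cong
    (trans (*-homo -B (𝒱 raw (suc n))) (*-congʳ eval₂-𝒱-1))
    (trans (-‿homo (C raw P.* 𝒱 raw n)) (-‿cong (trans (*-homo (C raw) (𝒱 raw n)) (*-congʳ eval₂-C)))))
    where
    module P = CommutativeRing R[B,C]
    -B = P.- (B raw)

  eval₂-∣-zero : ∀ {P Q} → RawSemiringDefinitions._∣_ (RawRing.rawSemiring (Poly₂ raw)) P Q →
                 eval₂ raw P b c ≈ 0# → eval₂ raw Q b c ≈ 0#
  eval₂-∣-zero {P} {Q} (M , MP≈Q) P≈0 =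
    trans (sym (⟦⟧-cong {M B,C.* P} {Q} MP≈Q)) (trans (*-homo M P) (trans (*-congˡ P≈0) (zeroʳ _)))
    where module B,C = CommutativeRing R[B,C]

-- Finite fields

module Powers (R : CommutativeRing a ℓ) where

  open CommutativeRing R hiding (zero)
  open CommutativeSemiringExp commutativeSemiring
  open SetoidReasoning setoid

  1^n≈1 : ∀ n → 1# ^ n ≈ 1#
  1^n≈1 zero    = refl
  1^n≈1 (suc n) = trans (*-identityˡ _) (1^n≈1 n)

  ^-∣-≈1 : ∀ {x m n} → m ∣ n → x ^ m ≈ 1# → x ^ n ≈ 1#
  ^-∣-≈1 {x} {m} (divides k ≡.refl) xᵐ≈1 = begin
    x ^ (k ℕ.* m)   ≡⟨ ≡.cong (x ^_) (ℕ.*-comm k m) ⟩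
    x ^ (m ℕ.* k)   ≈⟨ ^-assocʳ x m k ⟨
    (x ^ m) ^ k     ≈⟨ ^-congˡ k xᵐ≈1 ⟩
    1# ^ k          ≈⟨ 1^n≈1 k ⟩
    1#              ∎

  -- Subtraction of exponents without inverses: over the natural numbers Bézout's identity reads d +
  -- k n = l m, and x^d is what remains once x^(k n) = 1 is removed.
  ^-+-≈1 : ∀ {x} k {m n l} → m ℕ.+ k ℕ.* n ≡ l → x ^ n ≈ 1# → x ^ l ≈ 1# → x ^ m ≈ 1#
  ^-+-≈1 {x} k {m} {n} ≡.refl xⁿ≈1 xˡ≈1 = begin
    x ^ m                    ≈⟨ *-identityʳ _ ⟨
    x ^ m * 1#               ≈⟨ *-congˡ (^-∣-≈1 {x} (divides k ≡.refl) xⁿ≈1) ⟨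
    x ^ m * x ^ (k ℕ.* n)    ≈⟨ ^-homo-* x m (k ℕ.* n) ⟨
    x ^ (m ℕ.+ k ℕ.* n)      ≈⟨ xˡ≈1 ⟩
    1#                       ∎

  ^-gcd-≈1 : ∀ {x} m n → x ^ m ≈ 1# → x ^ n ≈ 1# → x ^ gcd m n ≈ 1#
  ^-gcd-≈1 {x} m n xᵐ≈1 xⁿ≈1 with Bézout.identity (gcd-GCD m n)
  ... | Bézout.+- k l eq = ^-+-≈1 l eq xⁿ≈1 (^-∣-≈1 (divides k ≡.refl) xᵐ≈1)
  ... | Bézout.-+ k l eq = ^-+-≈1 k eq xᵐ≈1 (^-∣-≈1 (divides l ≡.refl) xⁿ≈1)

  ^-comm : ∀ x m n → (x ^ m) ^ n ≈ (x ^ n) ^ m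
  ^-comm x m n = begin
    (x ^ m) ^ n     ≈⟨ ^-assocʳ x m n ⟩
    x ^ (m ℕ.* n)   ≡⟨ ≡.cong (x ^_) (ℕ.*-comm m n) ⟩
    x ^ (n ℕ.* m)   ≈⟨ ^-assocʳ x n m ⟨
    (x ^ n) ^ m     ∎

fieldRing : HeytingField c ℓ₁ ℓ₂ → CommutativeRing c ℓ₁
fieldRing F = HeytingCommutativeRing.commutativeRing (HeytingField.heytingCommutativeRing F)

module FiniteField (F : HeytingField c ℓ₁ ℓ₂) {n : ℕ} (hasOrder : HasOrder F n) where

  open HeytingField F using (_#_; tight; #⇒invertible; invertible⇒#)
  private
    R : CommutativeRing _ _
    R = fieldRing F
  open CommutativeRing R hiding (zero)
  open CommutativeSemiringExp commutativeSemiring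
  open SemiringMult semiring using () renaming (_×_ to _ו_)
  open GroupProperties +-group using (x∙y⁻¹≈ε⇒x≈y; identityʳ-unique)
  open Powers R
  open IntegerCoefficientSolver R
  open Inverse hasOrder using (to; from; to-cong; strictlyInverseˡ; strictlyInverseʳ)
  open SetoidReasoning setoid

  to-injective : ∀ {x y} → to x ≡ to y → x ≈ y
  to-injective {x} {y} eq = begin
    x             ≈⟨ strictlyInverseʳ x ⟨
    from (to x)   ≡⟨ ≡.cong from eq ⟩
    from (to y)   ≈⟨ strictlyInverseʳ y ⟩
    y             ∎

  from-injective : ∀ {i j} → from i ≈ from j → i ≡ j
  from-injective {i} {j} eq = ≡.trans (≡.sym (strictlyInverseˡ i)) (≡.trans (to-cong eq) (strictlyInverseˡ j))

  infix 4 _≟_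
  _≟_ : Decidable _≈_
  x ≟ y = map′ to-injective to-cong (to x ≟ᶠ to y)

  instance
    n≢0 : NonZero n
    n≢0 = ℕ.>-nonZero (ℕ.≤-<-trans ℕ.z≤n (toℕ<n (to 0#)))

  -- In a Heyting field apartness is invertibility of the difference. As 1 - 0 is invertible, 1 is
  -- apart from 0, and tightness forbids equality.
  1≉0 : ¬ 1# ≈ 0#
  1≉0 1≈0 = proj₂ (tight 1# 0#) 1≈0 (invertible⇒# (1# , 1*[1-0]≈1 , trans (*-comm _ _) 1*[1-0]≈1))
    where
    1*[1-0]≈1 : 1# * (1# - 0#) ≈ 1#
    1*[1-0]≈1 = solve 0 (con (+ 1) :* (con (+ 1) :- con (+ 0)) := con (+ 1)) refl

  -- Apartness comes with no decision procedure, so the inverse is sought among all n elements. A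
  -- failed search shows that x is not apart from 0, and then tightness gives x = 0.
  inverse : ∀ x → ¬ x ≈ 0# → ∃[ y ] x * y ≈ 1#
  inverse x x≉0 with any? (λ i → x * from i ≟ 1#)
  ... | yes (i , eq) = from i , eq
  ... | no ∄inverse  = contradiction (proj₁ (tight x 0#) ¬x#0) x≉0
    where
    ¬x#0 : ¬ x # 0#
    ¬x#0 x#0 with y , _ , eq ← #⇒invertible x#0 = ∄inverse (to y , (begin
      x * from (to y)   ≈⟨ *-congˡ (strictlyInverseʳ y) ⟩
      x * y             ≈⟨ solve 2 (λ x y → x :* y := (x :- con (+ 0)) :* y) refl x y ⟩
      (x - 0#) * y      ≈⟨ eq ⟩
      1#                ∎))

  xy≈0⇒y≈0 : ∀ {x y} → ¬ x ≈ 0# → x * y ≈ 0# → y ≈ 0#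
  xy≈0⇒y≈0 {x} {y} x≉0 xy≈0 with x⁻¹ , xx⁻¹≈1 ← inverse x x≉0 = begin
    y                ≈⟨ *-identityˡ y ⟨
    1# * y           ≈⟨ *-congʳ xx⁻¹≈1 ⟨
    x * x⁻¹ * y      ≈⟨ solve 3 (λ x z y → x :* z :* y := z :* (x :* y)) refl x x⁻¹ y ⟩
    x⁻¹ * (x * y)    ≈⟨ *-congˡ xy≈0 ⟩
    x⁻¹ * 0#         ≈⟨ zeroʳ x⁻¹ ⟩
    0#               ∎

  xy≈0⇒x≈0⊎y≈0 : ∀ {x y} → x * y ≈ 0# → x ≈ 0# ⊎ y ≈ 0#
  xy≈0⇒x≈0⊎y≈0 {x} xy≈0 with x ≟ 0#
  ... | yes x≈0 = inj₁ x≈0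
  ... | no x≉0  = inj₂ (xy≈0⇒y≈0 x≉0 xy≈0)

  *-cancelˡ : ∀ {x y z} → ¬ x ≈ 0# → x * y ≈ x * z → y ≈ z
  *-cancelˡ {x} {y} {z} x≉0 xy≈xz = x∙y⁻¹≈ε⇒x≈y y z (xy≈0⇒y≈0 x≉0 (begin
    x * (y - z)      ≈⟨ solve 3 (λ x y z → x :* (y :- z) := x :* y :- x :* z) refl x y z ⟩
    x * y - x * z    ≈⟨ +-congʳ xy≈xz ⟩
    x * z - x * z    ≈⟨ -‿inverseʳ _ ⟩
    0#               ∎))

  x²≈y²⇒x≈y⊎x≈-y : ∀ {x y} → x * x ≈ y * y → x ≈ y ⊎ x ≈ - y
  x²≈y²⇒x≈y⊎x≈-y {x} {y} x²≈y² with xy≈0⇒x≈0⊎y≈0 (begin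
    (x - y) * (x - - y)   ≈⟨ solve 2 (λ x y → (x :- y) :* (x :- :- y) := x :* x :- y :* y) refl x y ⟩
    x * x - y * y         ≈⟨ +-congʳ x²≈y² ⟩
    y * y - y * y         ≈⟨ -‿inverseʳ _ ⟩
    0#                    ∎)
  ... | inj₁ eq = inj₁ (x∙y⁻¹≈ε⇒x≈y x y eq)
  ... | inj₂ eq = inj₂ (x∙y⁻¹≈ε⇒x≈y x (- y) eq)

  ^-≉0 : ∀ {x} k → ¬ x ≈ 0# → ¬ x ^ k ≈ 0#
  ^-≉0 zero    x≉0 = 1≉0
  ^-≉0 (suc k) x≉0 = ^-≉0 k x≉0 ∘ xy≈0⇒y≈0 x≉0

  ^-collision : ∀ {x i j} → ¬ x ≈ 0# → i < j → x ^ i ≈ x ^ j → x ^ (j ∸ i) ≈ 1#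
  ^-collision {x} {i} {j} x≉0 i<j eq = *-cancelˡ (^-≉0 i x≉0) (begin
    x ^ i * x ^ (j ∸ i)    ≈⟨ ^-homo-* x i (j ∸ i) ⟨
    x ^ (i ℕ.+ (j ∸ i))    ≡⟨ ≡.cong (x ^_) (m+[n∸m]≡n (ℕ.<⇒≤ i<j)) ⟩
    x ^ j                  ≈⟨ eq ⟨
    x ^ i                  ≈⟨ *-identityʳ _ ⟨
    x ^ i * 1#             ∎)

  pigeonhole-≈ : ∀ {k} → n < k → (f : Fin k → Carrier) → ∃[ i ] ∃[ j ] i Fin.< j × f i ≈ f j
  pigeonhole-≈ n<k f with i , j , i<j , eq ← pigeonhole n<k (to ∘ f) = i , j , i<j , to-injective eq

  -- Translation by 1 permutes the elements, so their sum S satisfies S + n · 1 = S.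
  n×1≈0 : n ו 1# ≈ 0#
  n×1≈0 = identityʳ-unique (sum from) (n ו 1#) (begin
    sum from + n ו 1#                ≈⟨ +-congˡ (sum-replicate n) ⟨
    sum from + sum (replicate n 1#)   ≈⟨ ∑-distrib-+ from (replicate n 1#) ⟨
    sum (λ i → from i + 1#)           ≈⟨ sum-cong-≋ (λ i → strictlyInverseʳ (from i + 1#)) ⟨
    sum (λ i → from (shift i))
      ≈⟨ sum-permute from (permutation shift unshift shift∘unshift unshift∘shift) ⟨
    sum from                          ∎)
    where
    open CommutativeMonoidSum +-commutativeMonoid
    shift unshift : Fin n → Fin n
    shift i = to (from i + 1#)
    unshift i = to (from i - 1#)

    shift∘unshift : ∀ i → shift (unshift i) ≡ i
    shift∘unshift i = from-injective (begin
      from (shift (unshift i))   ≈⟨ strictlyInverseʳ _ ⟩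
      from (unshift i) + 1#      ≈⟨ +-congʳ (strictlyInverseʳ _) ⟩
      from i - 1# + 1#           ≈⟨ solve 1 (λ x → x :- con (+ 1) :+ con (+ 1) := x) refl (from i) ⟩
      from i                     ∎)

    unshift∘shift : ∀ i → unshift (shift i) ≡ i
    unshift∘shift i = from-injective (begin
      from (unshift (shift i))   ≈⟨ strictlyInverseʳ _ ⟩
      from (shift i) - 1#        ≈⟨ +-congʳ (strictlyInverseʳ _) ⟩
      from i + 1# - 1#           ≈⟨ solve 1 (λ x → x :+ con (+ 1) :- con (+ 1) := x) refl (from i) ⟩
      from i                     ∎)

  private
    n<2+pred[n] : n < 2 ℕ.+ pred n
    n<2+pred[n] = s≤s (ℕ.≤-reflexive (≡.sym (suc-pred n)))

  -- If y were missed, then 0, y and the n - 1 powers x^0, ..., x^(n-2) would be n + 1 distinct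
  -- elements of a set of size n.
  faithful-powers⇒primitive : ∀ {x} → ¬ x ≈ 0# →
    (∀ t → 0 < t → t < pred n → ¬ x ^ t ≈ 1#) → PrimitiveElement F x
  faithful-powers⇒primitive {x} x≉0 faithful = x≉0 , reach
    where
    reach : ∀ y → ¬ y ≈ 0# → ∃[ k ] x ^ k ≈ y
    reach y y≉0 with any? (λ (i : Fin (pred n)) → x ^ toℕ i ≟ y)
    ... | yes (i , eq) = toℕ i , eq
    ... | no ∄i with pigeonhole-≈ n<2+pred[n] list
      where
      list : Fin (2 ℕ.+ pred n) → Carrier
      list zero          = 0#
      list (suc zero)    = y
      list (suc (suc i)) = x ^ toℕ i
    ...   | zero        , suc zero    , _       , eq = contradiction (sym eq) y≉0
    ...   | zero        , suc (suc j) , _       , eq = contradiction (sym eq) (^-≉0 (toℕ j) x≉0)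
    ...   | suc zero    , suc zero    , s<s ()  , _
    ...   | suc zero    , suc (suc j) , _       , eq = contradiction (j , sym eq) ∄i
    ...   | suc (suc i) , suc zero    , s<s ()  , _
    ...   | suc (suc i) , suc (suc j) , s<s (s<s i<j) , eq = contradiction (^-collision x≉0 i<j eq)
      (faithful (toℕ j ∸ toℕ i) (ℕ.m<n⇒0<n∸m i<j) (ℕ.≤-<-trans (ℕ.m∸n≤m (toℕ j) (toℕ i)) (toℕ<n j)))

  module Generator {g : Carrier} (g-primitive : PrimitiveElement F g) where

    g≉0 : ¬ g ≈ 0#
    g≉0 = proj₁ g-primitive

    log : ∀ x → ¬ x ≈ 0# → ∃[ k ] g ^ k ≈ x
    log = proj₂ g-primitive

    -- When g^t = 1, a nonzero element is determined by its logarithm modulo t; together with 0 this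
    -- leaves room for at most t + 1 elements. `log` may answer differently for equal arguments, but
    -- only the injectivity of `residue` matters.
    gᵗ≈1⇒n≤1+t : ∀ t → 0 < t → g ^ t ≈ 1# → n ≤ suc t
    gᵗ≈1⇒n≤1+t t 0<t gᵗ≈1 = injective⇒≤ {f = residue ∘ from} (from-injective ∘ residue-injective)
      where
      instance
        t≢0 : NonZero t
        t≢0 = ℕ.>-nonZero 0<t

      g^[k%t]≈gᵏ : ∀ k → g ^ (k % t) ≈ g ^ k
      g^[k%t]≈gᵏ k = begin
        g ^ (k % t)                              ≈⟨ *-identityʳ _ ⟨
        g ^ (k % t) * 1#                         ≈⟨ *-congˡ (^-∣-≈1 (divides (k / t) ≡.refl) gᵗ≈1) ⟨
        g ^ (k % t) * g ^ (k / t ℕ.* t)          ≈⟨ ^-homo-* g (k % t) (k / t ℕ.* t) ⟨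
        g ^ (k % t ℕ.+ k / t ℕ.* t)              ≡⟨ ≡.cong (g ^_) (m≡m%n+[m/n]*n k t) ⟨
        g ^ k                                    ∎

      residue : Carrier → Fin (suc t)
      residue x with x ≟ 0#
      ... | yes _  = zero
      ... | no x≉0 = suc (Fin.fromℕ< (m%n<n (proj₁ (log x x≉0)) t))

      residue-injective : ∀ {x y} → residue x ≡ residue y → x ≈ y
      residue-injective {x} {y} eq with x ≟ 0# | y ≟ 0#
      ... | yes x≈0 | yes y≈0 = trans x≈0 (sym y≈0)
      residue-injective () | yes _ | no _
      residue-injective () | no _  | yes _
      ... | no x≉0  | no y≉0  with log x x≉0 | log y y≉0
      ...   | k , gᵏ≈x | l , gˡ≈y = begin
        x             ≈⟨ gᵏ≈x ⟨
        g ^ k         ≈⟨ g^[k%t]≈gᵏ k ⟨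
        g ^ (k % t)   ≡⟨ ≡.cong (g ^_) (fromℕ<-injective _ _ (m%n<n k t) (m%n<n l t) (sucᶠ-injective eq)) ⟩
        g ^ (l % t)   ≈⟨ g^[k%t]≈gᵏ l ⟩
        g ^ l         ≈⟨ gˡ≈y ⟩
        y             ∎

    gᵗ≈1⇒pred[n]≤t : ∀ t → 0 < t → g ^ t ≈ 1# → pred n ≤ t
    gᵗ≈1⇒pred[n]≤t t 0<t gᵗ≈1 = ℕ.pred-mono-≤ (gᵗ≈1⇒n≤1+t t 0<t gᵗ≈1)

    private
      -- Two of the n + 1 elements 0, g^0, ..., g^(n-1) agree, and their exponents differ by at most
      -- n - 1. With the lower bound `gᵗ≈1⇒pred[n]≤t` the order of g is exactly n - 1.
      period : ∃[ t ] 0 < t × t ≤ pred n × g ^ t ≈ 1#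
      period with pigeonhole-≈ n<2+pred[n] list
        where
        list : Fin (2 ℕ.+ pred n) → Carrier
        list zero    = 0#
        list (suc i) = g ^ toℕ i
      ... | zero  , suc j , _       , eq = contradiction (sym eq) (^-≉0 (toℕ j) g≉0)
      ... | suc i , suc j , s<s i<j , eq =
        toℕ j ∸ toℕ i , ℕ.m<n⇒0<n∸m i<j ,
        ℕ.≤-trans (ℕ.m∸n≤m (toℕ j) (toℕ i)) (ℕ.<⇒≤pred (toℕ<n j)) ,
        ^-collision g≉0 i<j eq

    0<pred[n] : 0 < pred n
    0<pred[n] with t , 0<t , t≤pred[n] , _ ← period = ℕ.<-≤-trans 0<t t≤pred[n]

    g^pred[n]≈1 : g ^ pred n ≈ 1#
    g^pred[n]≈1 with t , 0<t , t≤pred[n] , gᵗ≈1 ← period =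
      ≡.subst (λ k → g ^ k ≈ 1#) (ℕ.≤-antisym t≤pred[n] (gᵗ≈1⇒pred[n]≤t t 0<t gᵗ≈1)) gᵗ≈1

    -- By Bézout g^d = 1 also for d = gcd(t, n - 1), and a positive exponent of this kind cannot be
    -- smaller than n - 1.
    gᵗ≈1⇒pred[n]∣t : ∀ t → g ^ t ≈ 1# → pred n ∣ t
    gᵗ≈1⇒pred[n]∣t t gᵗ≈1 = ≡.subst (_∣ t) d≡pred[n] (gcd[m,n]∣m t (pred n))
      where
      d = gcd t (pred n)
      instance
        pred[n]≢0 : NonZero (pred n)
        pred[n]≢0 = ℕ.>-nonZero 0<pred[n]
      0<d : 0 < d
      0<d = ℕ.n≢0⇒n>0 (λ d≡0 → ℕ.<⇒≢ 0<pred[n] (≡.sym (0∣⇒≡0 (≡.subst (_∣ pred n) d≡0 (gcd[m,n]∣n t (pred n))))))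
      d≡pred[n] : d ≡ pred n
      d≡pred[n] = ℕ.≤-antisym (∣⇒≤ (gcd[m,n]∣n t (pred n)))
        (gᵗ≈1⇒pred[n]≤t d 0<d (^-gcd-≈1 t (pred n) gᵗ≈1 g^pred[n]≈1))

    xⁿ≈x : ∀ x → x ^ n ≈ x
    xⁿ≈x x = trans (≡.subst (λ k → x ^ n ≈ x ^ k) (≡.sym (suc-pred n)) refl) x*x^pred[n]≈x
      where
      x*x^pred[n]≈x : x * x ^ pred n ≈ x
      x*x^pred[n]≈x with x ≟ 0#
      ... | yes x≈0 = trans (*-congʳ x≈0) (trans (zeroˡ _) (sym x≈0))
      ... | no x≉0 with k , gᵏ≈x ← log x x≉0 = begin
        x * x ^ pred n          ≈⟨ *-congˡ (^-congˡ (pred n) gᵏ≈x) ⟨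
        x * (g ^ k) ^ pred n    ≈⟨ *-congˡ (^-comm g k (pred n)) ⟩
        x * (g ^ pred n) ^ k    ≈⟨ *-congˡ (^-congˡ k g^pred[n]≈1) ⟩
        x * 1# ^ k              ≈⟨ *-congˡ (1^n≈1 k) ⟩
        x * 1#                  ≈⟨ *-identityʳ x ⟩
        x                       ∎

    -- A square root of 1 in a field is 1 or -1, and h is too small for g^h = 1.
    g^half≈-1 : ∀ h → pred n ≡ h ℕ.+ h → g ^ h ≈ - 1#
    g^half≈-1 h pred[n]≡h+h with x²≈y²⇒x≈y⊎x≈-y {g ^ h} {1#} (begin
      g ^ h * g ^ h      ≈⟨ ^-homo-* g h h ⟨
      g ^ (h ℕ.+ h)      ≡⟨ ≡.cong (g ^_) pred[n]≡h+h ⟨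
      g ^ pred n         ≈⟨ g^pred[n]≈1 ⟩
      1#                 ≈⟨ *-identityʳ 1# ⟨
      1# * 1#            ∎)
    ... | inj₂ eq = eq
    ... | inj₁ eq = contradiction (gᵗ≈1⇒pred[n]≤t h 0<h eq) (ℕ.<⇒≱ (≡.subst (h <_) (≡.sym pred[n]≡h+h) (ℕ.m<m+n h 0<h)))
      where
      0<h : 0 < h
      0<h = ℕ.n≢0⇒n>0 λ h≡0 → ℕ.<⇒≢ 0<pred[n] (≡.sym (≡.trans pred[n]≡h+h (≡.cong (λ k → k ℕ.+ k) h≡0)))

-- The Frobenius map in characteristic r

module Frobenius (R : CommutativeRing a ℓ) {r : ℕ} (r-prime : Prime r) where

  open CommutativeRing R hiding (zero)
  open CommutativeSemiringExp commutativeSemiring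
  open SemiringMult semiring renaming (_×_ to _ו_)
  open CommutativeMonoidSum +-commutativeMonoid
  open CommutativeSemiringBinomial commutativeSemiring using (theorem; binomial; binomialTerm)
  open SetoidReasoning setoid

  module _ (r×1≈0 : r ו 1# ≈ 0#) where

    r∣n⇒n×x≈0 : ∀ {n} x → r ∣ n → n ו x ≈ 0#
    r∣n⇒n×x≈0 x (divides k ≡.refl) = begin
      (k ℕ.* r) ו x          ≈⟨ ×-assocˡ x k r ⟨
      k ו (r ו x)            ≈⟨ ×-congʳ k (×-congʳ r (*-identityˡ x)) ⟨
      k ו (r ו (1# * x))     ≈⟨ ×-congʳ k (×-assoc-* r 1# x) ⟨
      k ו (r ו 1# * x)       ≈⟨ ×-congʳ k (trans (*-congʳ r×1≈0) (zeroˡ x)) ⟩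
      k ו 0#                 ≈⟨ sum-replicate k ⟨
      sum (replicate k 0#)   ≈⟨ sum-replicate-zero k ⟩
      0#                     ∎

    ^r-homo-+ : ∀ x y → (x + y) ^ r ≈ x ^ r + y ^ r
    ^r-homo-+ x y = go r ≡.refl
      where
      -- `r` is a module parameter; the copy `n` can be matched as a successor, so that the first
      -- and last binomial terms split off.
      go : ∀ n → n ≡ r → (x + y) ^ n ≈ x ^ n + y ^ n
      go zero    0≡r = contradiction r-prime (≡.subst (λ k → ¬ Prime k) 0≡r ¬prime[0])
      go n@(suc n′) n≡r = begin
        (x + y) ^ n                                       ≈⟨ theorem n x y ⟩
        t zero + sum (λ i → t (suc i))                    ≈⟨ +-congˡ (sum-init-last (λ i → t (suc i))) ⟩
        t zero + (sum inner + t (fromℕ n))                ≈⟨ +-cong first (+-cong inner≈0 last) ⟩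
        y ^ n + (0# + x ^ n)                              ≈⟨ +-congˡ (+-identityˡ _) ⟩
        y ^ n + x ^ n                                     ≈⟨ +-comm _ _ ⟩
        x ^ n + y ^ n                                     ∎
        where
        t : Fin (suc n) → Carrier
        t = binomialTerm x y n
        inner : Fin n′ → Carrier
        inner i = t (suc (inject₁ i))

        first : t zero ≈ y ^ n
        first = begin
          (n choose 0) ו (1# * y ^ n)
            ≡⟨ ≡.cong (_ו (1# * y ^ n)) (≡.trans (nCk≡nC[n∸k] {0} {n} ℕ.z≤n) (nCn≡1 n)) ⟩
          1 ו (1# * y ^ n)         ≈⟨ ×-homo-1 _ ⟩
          1# * y ^ n               ≈⟨ *-identityˡ _ ⟩
          y ^ n                    ∎

        last : t (fromℕ n) ≈ x ^ n
        last = begin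
          t (fromℕ n)
            ≡⟨ ≡.cong (λ k → (n choose k) ו (x ^ k * y ^ (n ∸ k))) (toℕ-fromℕ n) ⟩
          (n choose n) ו (x ^ n * y ^ (n ∸ n))
            ≡⟨ ≡.cong₂ (λ k l → k ו (x ^ n * y ^ l)) (nCn≡1 n) (ℕ.n∸n≡0 n) ⟩
          1 ו (x ^ n * 1#)                     ≈⟨ ×-homo-1 _ ⟩
          x ^ n * 1#                           ≈⟨ *-identityʳ _ ⟩
          x ^ n                                ∎

        inner≈0 : sum inner ≈ 0#
        inner≈0 = trans (sum-cong-≋ {n′} {inner} {replicate n′ 0#} (λ i → r∣n⇒n×x≈0 (binomial x y n (suc (inject₁ i)))
          (≡.subst (λ m → r ∣ m choose suc (toℕ (inject₁ i))) (≡.sym n≡r)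
            (prime∣choose r-prime z<s (≡.subst₂ (λ k m → suc k < m) (≡.sym (toℕ-inject₁ i)) n≡r (s<s (toℕ<n i)))))))
          (sum-replicate-zero n′)

    ^r^k-homo-+ : ∀ k x y → (x + y) ^ (r ℕ.^ k) ≈ x ^ (r ℕ.^ k) + y ^ (r ℕ.^ k)
    ^r^k-homo-+ zero    x y = trans (*-identityʳ _) (sym (+-cong (*-identityʳ x) (*-identityʳ y)))
    ^r^k-homo-+ (suc k) x y = begin
      (x + y) ^ (r ℕ.* rᵏ)                 ≈⟨ ^-assocʳ (x + y) r rᵏ ⟨
      ((x + y) ^ r) ^ rᵏ                   ≈⟨ ^-congˡ rᵏ (^r-homo-+ x y) ⟩
      (x ^ r + y ^ r) ^ rᵏ                 ≈⟨ ^r^k-homo-+ k (x ^ r) (y ^ r) ⟩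
      (x ^ r) ^ rᵏ + (y ^ r) ^ rᵏ          ≈⟨ +-cong (^-assocʳ x r rᵏ) (^-assocʳ y r rᵏ) ⟩
      x ^ (r ℕ.* rᵏ) + y ^ (r ℕ.* rᵏ)      ∎
      where rᵏ = r ℕ.^ k

-- Vanishing of a least common multiple at a point

module _ (R : CommutativeRing a ℓ) where

  open CommutativeRing R hiding (zero) renaming (rawRing to raw)
  open RawSemiringDefinitions (RawRing.rawSemiring raw) using () renaming (_∣_ to _∣ᴿ_; product to productᴿ)
  open SemigroupDivisibility *-semigroup using (x∣ʳy⇒x∣ʳzy)

  ∣-product : ∀ {s} (v : Fin s → Carrier) i → v i ∣ᴿ productᴿ v
  ∣-product v zero    = productᴿ (v ∘ suc) , *-comm _ _
  ∣-product v (suc i) = x∣ʳy⇒x∣ʳzy (v zero) (∣-product (v ∘ suc) i)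

module _ (R : CommutativeRing a ℓ)
  (1≉0 : ¬ CommutativeRing._≈_ R (CommutativeRing.1# R) (CommutativeRing.0# R))
  (noZeroDivisors : ∀ {x y} → CommutativeRing._≈_ R (CommutativeRing._*_ R x y) (CommutativeRing.0# R) →
    CommutativeRing._≈_ R x (CommutativeRing.0# R) ⊎ CommutativeRing._≈_ R y (CommutativeRing.0# R))
  (b c : CommutativeRing.Carrier R) where

  open CommutativeRing R hiding (zero) renaming (rawRing to raw)
  open BivariateEvaluation R b c
  open IsRingHomomorphism eval₂-isRingHomomorphism
  open RawSemiringDefinitions (RawRing.rawSemiring (Poly₂ raw)) using () renaming (product to productᴿ)

  eval₂-product≉0 : ∀ {s} (v : Fin s → RawRing.Carrier (Poly₂ raw)) →
                    (∀ i → ¬ eval₂ raw (v i) b c ≈ 0#) → ¬ eval₂ raw (productᴿ v) b c ≈ 0#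
  eval₂-product≉0 {zero}  v v≉0 eq = 1≉0 (trans (sym 1#-homo) eq)
  eval₂-product≉0 {suc s} v v≉0 eq
    with noZeroDivisors (trans (sym (*-homo (v zero) (productᴿ (v ∘ suc)))) eq)
  ... | inj₁ v₀≈0 = v≉0 zero v₀≈0
  ... | inj₂ Π≈0  = eval₂-product≉0 (v ∘ suc) (v≉0 ∘ suc) Π≈0

  module _ {s} {v : Fin s → RawRing.Carrier (Poly₂ raw)} {l} (l-isLCM : IsLCM (Poly₂ raw) v l) where

    open IsLCM l-isLCM

    eval₂-lcm≉0⇒ : ¬ eval₂ raw l b c ≈ 0# → ∀ i → ¬ eval₂ raw (v i) b c ≈ 0#
    eval₂-lcm≉0⇒ l≉0 i vᵢ≈0 = l≉0 (eval₂-∣-zero {v i} {l} (multiple i) vᵢ≈0)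

    -- The product is a common multiple, so the lcm divides it; over a domain a product of nonzero
    -- values is nonzero. The lcm itself never has to be computed.
    eval₂-lcm≉0⇐ : (∀ i → ¬ eval₂ raw (v i) b c ≈ 0#) → ¬ eval₂ raw l b c ≈ 0#
    eval₂-lcm≉0⇐ v≉0 l≈0 = eval₂-product≉0 v v≉0
      (eval₂-∣-zero {l} {productᴿ v} (least (∣-product (polynomialRing (polynomialRing R)) v)) l≈0)

-- Irreducible quadratics and their discriminants

module IrreducibleQuadratic (F : HeytingField c ℓ₁ ℓ₂) {n : ℕ} (hasOrder : HasOrder F n)
  {b c : HeytingField.Carrier F} (irreducible : IrreduciblePoly F (quadratic F b c)) where

  private
    R : CommutativeRing _ _
    R = fieldRing F
  open CommutativeRing R hiding (zero) renaming (rawRing to raw)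
  open FiniteField F hasOrder
  open IntegerCoefficientSolver R
  open SetoidReasoning setoid

  private
    -- Evaluation at -u kills every multiple of u + X but not 1.
    linear∤1 : ∀ u → ¬ RawSemiringDefinitions._∣_ (RawRing.rawSemiring (Poly raw)) (u ∷ 1# ∷ []) (1# ∷ [])
    linear∤1 u (p , pq≈1) = 1≉0 (begin
      1#                              ≈⟨ 1#-homo ⟨
      ev (1# ∷ [])                    ≈⟨ ⟦⟧-cong {mulₚ raw p (u ∷ 1# ∷ [])} {1# ∷ []} pq≈1 ⟨
      ev (mulₚ raw p (u ∷ 1# ∷ []))   ≈⟨ *-homo p (u ∷ 1# ∷ []) ⟩
      ev p * ev (u ∷ 1# ∷ [])
        ≈⟨ solve 2 (λ e u → e :* (u :+ (:- u) :* (con (+ 1) :+ (:- u) :* con (+ 0))) := con (+ 0)) refl (ev p) u ⟩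
      0#                              ∎)
      where
      ev : List Carrier → Carrier
      ev p = eval raw id p (- u)
      open IsRingHomomorphism (Evaluation.eval-isRingHomomorphism R R (Identity.isRingHomomorphism raw refl) (- u))

  -- By Vieta the other root would be -b - x, and f = (X - x)(X + b + x) would be a product of two
  -- nonunits.
  noRoot : ∀ x → ¬ c + b * x + x * x ≈ 0#
  noRoot x root with RawSemiringDefinitions.Irreducible.split-∣1 irreducible
                       {(- x) ∷ 1# ∷ []} {b + x ∷ 1# ∷ []} factorisation
    where
    factorisation : ∀ n → coeff raw (quadratic F b c) n ≈ coeff raw (mulₚ raw (- x ∷ 1# ∷ []) (b + x ∷ 1# ∷ [])) n
    factorisation 0 = begin
      c
        ≈⟨ solve 3 (λ c b x → c := (c :+ b :* x :+ x :* x) :+ ((:- x) :* (b :+ x) :+ con (+ 0))) refl c b x ⟩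
      (c + b * x + x * x) + (- x * (b + x) + 0#)   ≈⟨ +-congʳ root ⟩
      0# + (- x * (b + x) + 0#)              ≈⟨ +-identityˡ _ ⟩
      - x * (b + x) + 0#                     ∎
    factorisation 1 = solve 2 (λ b x → b := (:- x) :* con (+ 1) :+ (con (+ 1) :* (b :+ x) :+ con (+ 0))) refl b x
    factorisation 2 = sym (*-identityˡ 1#)
    factorisation (suc (suc (suc n))) = refl
  ... | inj₁ ∣1 = linear∤1 (- x) ∣1
  ... | inj₂ ∣1 = linear∤1 (b + x) ∣1

  discriminant : Carrier
  discriminant = b * b - (1# + 1#) * (1# + 1#) * c

  -- Completing the square, 4 f(x) = (2x + b)^2 - D; a square root y of D would give the root x = (y
  -- - b)/2.
  discriminant-nonsquare : ¬ 1# + 1# ≈ 0# → ∀ y → ¬ y * y ≈ discriminant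
  discriminant-nonsquare 2≉0 y y²≈D with t , 2t≈1 ← inverse (1# + 1#) 2≉0 =
    noRoot x (xy≈0⇒y≈0 2≉0 (xy≈0⇒y≈0 2≉0 (begin
      2# * (2# * (c + b * x + x * x))
        ≈⟨ solve 3 (λ b c x → 2ₚ :* (2ₚ :* (c :+ b :* x :+ x :* x)) := (2ₚ :* x :+ b) :* (2ₚ :* x :+ b) :- (b :* b :- 2ₚ :* 2ₚ :* c)) refl b c x ⟩
      (2# * x + b) * (2# * x + b) - discriminant  ≈⟨ +-congʳ (*-cong 2x+b≈y 2x+b≈y) ⟩
      y * y - discriminant                        ≈⟨ +-congʳ y²≈D ⟩
      discriminant - discriminant                 ≈⟨ -‿inverseʳ _ ⟩
      0#                                          ∎)))
    where
    2# = 1# + 1#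
    2ₚ : ∀ {n} → Polynomial n
    2ₚ = con (+ 1) :+ con (+ 1)
    x = t * (y - b)
    2x+b≈y : 2# * x + b ≈ y
    2x+b≈y = begin
      2# * (t * (y - b)) + b
        ≈⟨ solve 4 (λ s t y b → s :* (t :* (y :- b)) :+ b := (s :* t) :* (y :- b) :+ b) refl 2# t y b ⟩
      2# * t * (y - b) + b     ≈⟨ +-congʳ (*-congʳ 2t≈1) ⟩
      1# * (y - b) + b         ≈⟨ solve 2 (λ y b → con (+ 1) :* (y :- b) :+ b := y) refl y b ⟩
      y                        ∎

module OddOrder (F : HeytingField c ℓ₁ ℓ₂) {n : ℕ} (hasOrder : HasOrder F n) where

  private
    R : CommutativeRing _ _
    R = fieldRing F
  open CommutativeRing R hiding (zero)
  open FiniteField F hasOrder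
  open CommutativeSemiringExp commutativeSemiring
  open SemiringMult semiring renaming (_×_ to _ו_)
  open SetoidReasoning setoid

  -- If 1 + 1 = 0, then n · 1 = 1 + h (1 + 1) = 1, whereas n · 1 = 0 in a ring of n elements.
  2≉0 : ∀ h → n ≡ suc (h ℕ.+ h) → ¬ 1# + 1# ≈ 0#
  2≉0 h n≡1+2h 2≈0 = 1≉0 (begin
    1#                           ≈⟨ +-identityʳ 1# ⟨
    1# + 0#                      ≈⟨ +-congˡ 2h≈0 ⟨
    suc (h ℕ.+ h) ו 1#          ≡⟨ ≡.cong (_ו 1#) n≡1+2h ⟨
    n ו 1#                      ≈⟨ n×1≈0 ⟩
    0#                           ∎)
    where
    2h≈0 : (h ℕ.+ h) ו 1# ≈ 0#
    2h≈0 = begin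
      (h ℕ.+ h) ו 1#                  ≈⟨ ×-homo-+ 1# h h ⟩
      h ו 1# + h ו 1#                ≈⟨ +-cong (*-identityˡ _) (*-identityˡ _) ⟨
      1# * h ו 1# + 1# * h ו 1#      ≈⟨ distribʳ _ 1# 1# ⟨
      (1# + 1#) * h ו 1#              ≈⟨ *-congʳ 2≈0 ⟩
      0# * h ו 1#                     ≈⟨ zeroˡ _ ⟩
      0#                               ∎

  rᵏ×1≈0⇒r×1≈0 : ∀ r k → (r ℕ.^ k) ו 1# ≈ 0# → r ו 1# ≈ 0#
  rᵏ×1≈0⇒r×1≈0 r zero    1×1≈0 = contradiction (trans (sym (×-homo-1 1#)) 1×1≈0) 1≉0
  rᵏ×1≈0⇒r×1≈0 r (suc k) eq with xy≈0⇒x≈0⊎y≈0 (trans (sym (×1-homo-* r (r ℕ.^ k))) eq)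
  ... | inj₁ r≈0  = r≈0
  ... | inj₂ rᵏ≈0 = rᵏ×1≈0⇒r×1≈0 r k rᵏ≈0

  nonsquare⇒odd-power : ∀ {g} → PrimitiveElement F g → ∀ {x} → (∀ y → ¬ y * y ≈ x) → ∃[ k ] g ^ suc (k ℕ.+ k) ≈ x
  nonsquare⇒odd-power {g} (g≉0 , log) {x} nonsquare
    with k , gᵏ≈x ← log x (λ x≈0 → nonsquare 0# (trans (zeroˡ 0#) (sym x≈0)))
    with even-or-odd k
  ... | inj₁ (j , ≡.refl) = contradiction (trans (sym (^-homo-* g j j)) gᵏ≈x) (nonsquare (g ^ j))
  ... | inj₂ (j , ≡.refl) = j , gᵏ≈x

-- The quadratic extension

module _ (R : CommutativeRing a ℓ) where

  open CommutativeRing R hiding (zero) renaming (rawRing to raw)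
  open CommutativeSemiringExp commutativeSemiring
  open IntegerCoefficientSolver R
  open SetoidReasoning setoid

  -- Binet's formula: both sides obey the recurrence with characteristic polynomial (X - x)(X - y).
  -- The sequence is abstract so that the formula applies in K to the images under `ι` of values
  -- computed in F.
  lucas≈sumOfPowers : ∀ {b c x y} → x + y ≈ - b → x * y ≈ c →
    (v : ℕ → Carrier) → v 0 ≈ 1# + 1# → v 1 ≈ - b →
    (∀ n → v (suc (suc n)) ≈ (- b) * v (suc n) + - (c * v n)) →
    ∀ n → v n ≈ x ^ n + y ^ n
  lucas≈sumOfPowers {b} {c} {x} {y} x+y≈-b xy≈c v v₀≈2 v₁≈-b v-rec = go
    where
    go : ∀ n → v n ≈ x ^ n + y ^ n
    go 0 = v₀≈2
    go 1 = trans v₁≈-b (trans (sym x+y≈-b) (sym (+-cong (*-identityʳ x) (*-identityʳ y))))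
    go (suc (suc n)) = begin
      v (suc (suc n))
        ≈⟨ v-rec n ⟩
      (- b) * v (suc n) + - (c * v n)
        ≈⟨ +-cong (*-cong (sym x+y≈-b) (go (suc n))) (-‿cong (*-cong (sym xy≈c) (go n))) ⟩
      (x + y) * (x * x ^ n + y * y ^ n) + - (x * y * (x ^ n + y ^ n))
        ≈⟨ solve 4 (λ x y u v → (x :+ y) :* (x :* u :+ y :* v) :+ :- (x :* y :* (u :+ v)) := x :* (x :* u) :+ y :* (y :* v)) refl x y (x ^ n) (y ^ n) ⟩
      x * (x * x ^ n) + y * (y * y ^ n) ∎

module _ (S : CommutativeRing a ℓ) (R : CommutativeRing b ℓ₁)
  {φ : CommutativeRing.Carrier S → CommutativeRing.Carrier R}
  (φ-hom : IsRingHomomorphism (CommutativeRing.rawRing S) (CommutativeRing.rawRing R) φ) where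

  open CommutativeRing R hiding (zero) renaming (rawRing to raw)
  open IsRingHomomorphism φ-hom
  private
    module S = CommutativeRing S
    module S^ = CommutativeSemiringExp S.commutativeSemiring
  open CommutativeSemiringExp commutativeSemiring

  ^-homo : ∀ x n → φ (x S^.^ n) ≈ φ x ^ n
  ^-homo x zero    = 1#-homo
  ^-homo x (suc n) = trans (*-homo x (x S^.^ n)) (*-congˡ (^-homo x n))

  -homo : ∀ x y → φ (x S.- y) ≈ φ x - φ y
  -homo x y = trans (+-homo x (S.- y)) (+-congˡ (-‿homo y))

-- With q = 2h + 1, the numbers q - 1 and (q + 1)/2 become `h ℕ.+ h` and `suc h`, free of truncated
-- subtraction and division.
module QuadraticExtension
  (F : HeytingField c ℓ₁ ℓ₂) {q : ℕ} (F-order : HasOrder F q)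
  (K : HeytingField c′ ℓ₁′ ℓ₂′) (K-order : HasOrder K (q ℕ.^ 2))
  (ι : HeytingField.Carrier F → HeytingField.Carrier K)
  (ι-hom : IsRingHomomorphism (rawRing F) (rawRing K) ι)
  (q-power : OddPrimePower q)
  (h : ℕ) (q≡1+2h : q ≡ suc (h ℕ.+ h)) where

  module F where
    open CommutativeRing (fieldRing F) public hiding (zero)
    open FiniteField F F-order public
    open OddOrder F F-order public
    open CommutativeSemiringExp commutativeSemiring public

  open CommutativeRing (fieldRing K) hiding (zero) renaming (rawRing to raw)
  open FiniteField K K-order
  open OddOrder K K-order using (rᵏ×1≈0⇒r×1≈0)
  open CommutativeSemiringExp commutativeSemiring
  open SemiringMult semiring using () renaming (_×_ to _ו_)
  open GroupProperties +-group using (x∙y⁻¹≈ε⇒x≈y; x≈y⇒x∙y⁻¹≈ε; inverseˡ-unique)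
  open IsRingHomomorphism ι-hom
  open Powers (fieldRing K)
  open IntegerCoefficientSolver (fieldRing K)
  open SetoidReasoning setoid

  private
    2# : Carrier
    2# = 1# + 1#
    2ₚ : ∀ {n} → Polynomial n
    2ₚ = con (+ 1) :+ con (+ 1)

    F-2≉0 : ¬ F.1# F.+ F.1# F.≈ F.0#
    F-2≉0 = F.2≉0 h q≡1+2h

    ι-^ : ∀ x n → ι (x F.^ n) ≈ ι x ^ n
    ι-^ = ^-homo (fieldRing F) (fieldRing K) ι-hom

    ι-- : ∀ x y → ι (x F.- y) ≈ ι x - ι y
    ι-- = -homo (fieldRing F) (fieldRing K) ι-hom

    ι-2 : ι (F.1# F.+ F.1#) ≈ 2#
    ι-2 = trans (+-homo F.1# F.1#) (+-cong 1#-homo 1#-homo)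

  ι≈0⇒≈0 : ∀ {x} → ι x ≈ 0# → x F.≈ F.0#
  ι≈0⇒≈0 {x} ιx≈0 with x F.≟ F.0#
  ... | yes x≈0 = x≈0
  ... | no x≉0 with y , xy≈1 ← F.inverse x x≉0 = contradiction (begin
    1#           ≈⟨ 1#-homo ⟨
    ι F.1#       ≈⟨ ⟦⟧-cong xy≈1 ⟨
    ι (x F.* y)  ≈⟨ *-homo x y ⟩
    ι x * ι y    ≈⟨ *-congʳ ιx≈0 ⟩
    0# * ι y     ≈⟨ zeroˡ _ ⟩
    0#           ∎) 1≉0

  ι-injective : ∀ {x y} → ι x ≈ ι y → x F.≈ y
  ι-injective {x} {y} ιx≈ιy = GroupProperties.x∙y⁻¹≈ε⇒x≈y F.+-group x y
    (ι≈0⇒≈0 (trans (ι-- x y) (x≈y⇒x∙y⁻¹≈ε ιx≈ιy)))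

  2≉0 : ¬ 2# ≈ 0#
  2≉0 = F-2≉0 ∘ ι≈0⇒≈0 ∘ trans ι-2

  halfF : F.Carrier
  halfF = proj₁ (F.inverse _ F-2≉0)

  ½ : Carrier
  ½ = ι halfF

  2*½≈1 : 2# * ½ ≈ 1#
  2*½≈1 = begin
    2# * ½                              ≈⟨ *-congʳ ι-2 ⟨
    ι (F.1# F.+ F.1#) * ½               ≈⟨ *-homo _ _ ⟨
    ι ((F.1# F.+ F.1#) F.* halfF)   ≈⟨ ⟦⟧-cong (proj₂ (F.inverse _ F-2≉0)) ⟩
    ι F.1#                              ≈⟨ 1#-homo ⟩
    1#                                  ∎

  -- K has q^2 = r^(2k) elements, so r^(2k) · 1 = 0, and r · 1 = 0 because K has no zero divisors.
  -- The q-th power is then the k-fold iterate of the additive r-th power.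
  ^q-homo-+ : ∀ x y → (x + y) ^ q ≈ x ^ q + y ^ q
  ^q-homo-+ x y = ≡.subst (λ n → (x + y) ^ n ≈ x ^ n + y ^ n) (≡.sym q≡r^k)
    (Frobenius.^r^k-homo-+ (fieldRing K) r-prime r×1≈0 k x y)
    where
    open OddPrimePower q-power
    r×1≈0 : r ו 1# ≈ 0#
    r×1≈0 = rᵏ×1≈0⇒r×1≈0 r (k ℕ.* 2) (≡.subst (λ n → n ו 1# ≈ 0#)
      (≡.trans (≡.cong (ℕ._^ 2) q≡r^k) (ℕ.^-*-assoc r k 2)) n×1≈0)

  module Nonsquare {g : F.Carrier} (g-primitive : PrimitiveElement F g) where

    private
      module G = F.Generator g-primitive

    ι-fixed : ∀ x → ι x ^ q ≈ ι x
    ι-fixed x = trans (sym (ι-^ x q)) (⟦⟧-cong (G.xⁿ≈x x))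

    ιg^h≈-1 : ι g ^ h ≈ - 1#
    ιg^h≈-1 = begin
      ι g ^ h          ≈⟨ ι-^ g h ⟨
      ι (g F.^ h)      ≈⟨ ⟦⟧-cong (G.g^half≈-1 h (≡.cong pred q≡1+2h)) ⟩
      ι (F.- F.1#)     ≈⟨ -‿homo F.1# ⟩
      - ι F.1#         ≈⟨ -‿cong 1#-homo ⟩
      - 1#             ∎

    -1≉1 : ¬ - 1# ≈ 1#
    -1≉1 eq = 2≉0 (trans (+-congʳ (sym eq)) (-‿inverseˡ 1#))

    -- Euler's criterion in K: δ^(q-1) = (δ^2)^h = (g^h)^(2k+1), an odd power of -1.
    √nonsquare^q≈- : ∀ {δ} k → δ * δ ≈ ι (g F.^ suc (k ℕ.+ k)) → δ ^ q ≈ - δ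
    √nonsquare^q≈- {δ} k δ²≈ = begin
      δ ^ q                                ≡⟨ ≡.cong (δ ^_) q≡1+2h ⟩
      δ * δ ^ (h ℕ.+ h)                    ≈⟨ *-congˡ (^-homo-* δ h h) ⟩
      δ * (δ ^ h * δ ^ h)                  ≈⟨ *-congˡ (^-distrib-* δ δ h) ⟨
      δ * (δ * δ) ^ h                      ≈⟨ *-congˡ (^-congˡ h (trans δ²≈ (ι-^ g (suc (k ℕ.+ k))))) ⟩
      δ * (ι g ^ suc (k ℕ.+ k)) ^ h        ≈⟨ *-congˡ (^-comm (ι g) (suc (k ℕ.+ k)) h) ⟩
      δ * (ι g ^ h) ^ suc (k ℕ.+ k)        ≈⟨ *-congˡ (^-congˡ (suc (k ℕ.+ k)) ιg^h≈-1) ⟩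
      δ * (- 1# * (- 1#) ^ (k ℕ.+ k))      ≈⟨ *-congˡ (*-congˡ (^-homo-* (- 1#) k k)) ⟩
      δ * (- 1# * ((- 1#) ^ k * (- 1#) ^ k))  ≈⟨ *-congˡ (*-congˡ (^-distrib-* (- 1#) (- 1#) k)) ⟨
      δ * (- 1# * (- 1# * - 1#) ^ k)
        ≈⟨ *-congˡ (*-congˡ (^-congˡ k (solve 0 ((:- con (+ 1)) :* (:- con (+ 1)) := con (+ 1)) refl))) ⟩
      δ * (- 1# * 1# ^ k)                  ≈⟨ *-congˡ (*-congˡ (1^n≈1 k)) ⟩
      δ * (- 1# * 1#)
        ≈⟨ solve 1 (λ x → x :* ((:- con (+ 1)) :* con (+ 1)) := :- x) refl δ ⟩
      - δ                                  ∎

  ∃-outside : 1 < q → ∃[ β ] (∀ x → ¬ ι x ≈ β)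
  ∃-outside 1<q with ¬∀⟶∃¬ (q ℕ.^ 2) InImage inImage? ¬all
    where
    module F↔ = Inverse F-order
    module K↔ = Inverse K-order
    InImage : Fin (q ℕ.^ 2) → Set _
    InImage i = ∃[ j ] ι (F↔.from j) ≈ K↔.from i
    inImage? : ∀ i → Dec (InImage i)
    inImage? i = any? (λ j → ι (F↔.from j) ≟ K↔.from i)
    ¬all : ¬ (∀ i → InImage i)
    ¬all all = ℕ.<⇒≱ (n<n² 1<q) (injective⇒≤ {f = proj₁ ∘ all} λ {i} {j} eq →
      from-injective (trans (sym (proj₂ (all i))) (trans (reflexive (≡.cong (ι ∘ F↔.from) eq)) (proj₂ (all j)))))
  ... | i , ∉image = Inverse.from K-order i , λ x ιx≈β → ∉image (Inverse.to F-order x ,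
    trans (⟦⟧-cong (Inverse.strictlyInverseʳ F-order x)) ιx≈β)

  module Basis {β : Carrier} (β∉F : ∀ x → ¬ ι x ≈ β) where

    -- If y and y′ differed, β = (x′ - x)/(y - y′) would lie in F.
    coordinates-unique : ∀ {x y x′ y′} → ι x + ι y * β ≈ ι x′ + ι y′ * β → x F.≈ x′ × y F.≈ y′
    coordinates-unique {x} {y} {x′} {y′} eq with y F.- y′ F.≟ F.0#
    ... | yes y-y′≈0 = ι-injective (begin
      ι x                            ≈⟨ solve 2 (λ x z → x := x :+ z :- z) refl (ι x) (ι y * β) ⟩
      ι x + ι y * β - ι y * β        ≈⟨ +-cong eq (-‿cong (*-congʳ (⟦⟧-cong y≈y′))) ⟩
      ι x′ + ι y′ * β - ι y′ * β     ≈⟨ solve 2 (λ x z → x :+ z :- z := x) refl (ι x′) (ι y′ * β) ⟩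
      ι x′                           ∎) , y≈y′
      where
      y≈y′ : y F.≈ y′
      y≈y′ = GroupProperties.x∙y⁻¹≈ε⇒x≈y F.+-group y y′ y-y′≈0
    ... | no y-y′≉0 with s , [y-y′]s≈1 ← F.inverse (y F.- y′) y-y′≉0 = contradiction (begin
      ι ((x′ F.- x) F.* s)            ≈⟨ trans (*-homo _ s) (*-congʳ (ι-- x′ x)) ⟩
      (ι x′ - ι x) * ι s
        ≈⟨ solve 4 (λ x x′ z s → (x′ :- x) :* s := ((x′ :+ z) :- (x :+ z)) :* s) refl (ι x) (ι x′) (ι y′ * β) (ι s) ⟩
      ((ι x′ + ι y′ * β) - (ι x + ι y′ * β)) * ι s    ≈⟨ *-congʳ (+-congʳ eq) ⟨
      ((ι x + ι y * β) - (ι x + ι y′ * β)) * ι s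
        ≈⟨ solve 5 (λ x y y′ β s → ((x :+ y :* β) :- (x :+ y′ :* β)) :* s := (y :- y′) :* s :* β) refl (ι x) (ι y) (ι y′) β (ι s) ⟩
      (ι y - ι y′) * ι s * β          ≈⟨ *-congʳ (trans (*-homo _ s) (*-congʳ (ι-- y y′))) ⟨
      ι ((y F.- y′) F.* s) * β        ≈⟨ *-congʳ (trans (⟦⟧-cong [y-y′]s≈1) 1#-homo) ⟩
      1# * β                          ≈⟨ *-identityˡ β ⟩
      β                               ∎) (β∉F _)

    private
      combination : Fin (q ℕ.* q) → Carrier
      combination k = ι (Inverse.from F-order (proj₁ (remQuot {q} q k))) + ι (Inverse.from F-order (proj₂ (remQuot {q} q k))) * β

    -- The q^2 combinations are pairwise distinct, so one more element z must coincide with one of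
    -- them. `remQuot` and `combine` identify pairs of indices with numbers below q · q.
    coordinates : ∀ z → ∃[ x ] ∃[ y ] ι x + ι y * β ≈ z
    coordinates z with any? (λ k → combination k ≟ z)
    ... | yes (_ , eq) = _ , _ , eq
    ... | no ∄k with pigeonhole-≈ (s≤s (ℕ.≤-reflexive (≡.cong (q ℕ.*_) (ℕ.*-identityʳ q)))) list
      where
      list : Fin (suc (q ℕ.* q)) → Carrier
      list zero    = z
      list (suc k) = combination k
    ...   | zero  , suc l , _       , eq = contradiction (l , sym eq) ∄k
    ...   | suc k , suc l , s<s k<l , eq with x≈ , y≈ ← coordinates-unique eq =
      contradiction k<l (<ᶠ-irrefl (≡.trans (≡.sym (combine-remQuot {q} q k))
        (≡.trans (≡.cong₂ combine (F.from-injective x≈) (F.from-injective y≈)) (combine-remQuot {q} q l))))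

  1+2h*[1+q]≡q² : suc ((h ℕ.+ h) ℕ.* suc q) ≡ q ℕ.^ 2
  1+2h*[1+q]≡q² = ≡.subst (λ n → suc ((h ℕ.+ h) ℕ.* suc n) ≡ n ℕ.^ 2) (≡.sym q≡1+2h) (identity h)
    where
    identity : ∀ h → suc ((h ℕ.+ h) ℕ.* suc (suc (h ℕ.+ h))) ≡ suc (h ℕ.+ h) ℕ.* (suc (h ℕ.+ h) ℕ.* 1)
    identity = ℕSolver.solve-∀

  -- The roots of f in K and their orders

  module Quadratic {b c : F.Carrier}
    (irreducible : IrreduciblePoly F (quadratic F b c)) (c-primitive : PrimitiveElement F c) where

    open IrreducibleQuadratic F F-order irreducible
    open Nonsquare c-primitive
    private
      module G = F.Generator c-primitive
      V : ℕ → F.Carrier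
      V n = eval₂ (rawRing F) (𝒱 (rawRing F) n) b c

    IsRoot : Carrier → Set _
    IsRoot α = ι c + ι b * α + α * α ≈ 0#

    eval≈ : ∀ α → eval raw ι (quadratic F b c) α ≈ ι c + ι b * α + α * α
    eval≈ α = begin
      ι c + α * (ι b + α * (ι F.1# + α * 0#))   ≈⟨ +-congˡ (*-congˡ (+-congˡ (*-congˡ (+-congʳ 1#-homo)))) ⟩
      ι c + α * (ι b + α * (1# + α * 0#))
        ≈⟨ solve 3 (λ c b α → c :+ α :* (b :+ α :* (con (+ 1) :+ α :* con (+ 0))) := c :+ b :* α :+ α :* α) refl (ι c) (ι b) α ⟩
      ι c + ι b * α + α * α                     ∎

    root∉F : ∀ {α} → IsRoot α → ∀ x → ¬ ι x ≈ α
    root∉F {α} root x ιx≈α = noRoot x (ι≈0⇒≈0 (begin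
      ι (c F.+ b F.* x F.+ x F.* x)      ≈⟨ trans (+-homo _ _) (+-congʳ (+-homo _ _)) ⟩
      ι c + ι (b F.* x) + ι (x F.* x)    ≈⟨ +-cong (+-congˡ (*-homo b x)) (*-homo x x) ⟩
      ι c + ι b * ι x + ι x * ι x        ≈⟨ +-cong (+-congˡ (*-congˡ ιx≈α)) (*-cong ιx≈α ιx≈α) ⟩
      ι c + ι b * α + α * α              ≈⟨ root ⟩
      0#                                 ∎))

    1<q : 1 < q
    1<q = ≡.subst (1 <_) (ℕ.suc-pred q) (s<s G.0<pred[n])

    private
      ι-discriminant : ι discriminant ≈ ι b * ι b - 2# * 2# * ι c
      ι-discriminant = trans (ι-- _ _) (+-cong (*-homo b b)
        (-‿cong (trans (*-homo _ c) (*-congʳ (trans (*-homo _ _) (*-cong ι-2 ι-2))))))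

      discriminant-odd-power : ∃[ k ] c F.^ suc (k ℕ.+ k) F.≈ discriminant
      discriminant-odd-power = F.nonsquare⇒odd-power c-primitive (discriminant-nonsquare F-2≉0)

    √discriminant⇒root : ∀ {δ} → δ * δ ≈ ι discriminant → IsRoot (½ * (δ - ι b))
    √discriminant⇒root {δ} δ²≈D = xy≈0⇒y≈0 2≉0 (xy≈0⇒y≈0 2≉0 (begin
      2# * (2# * (ι c + ι b * α + α * α))
        ≈⟨ solve 4 (λ b c t δ → 2ₚ :* (2ₚ :* (c :+ b :* (t :* (δ :- b)) :+ t :* (δ :- b) :* (t :* (δ :- b))))
             := (2ₚ :* t :* (δ :- b) :+ b) :* (2ₚ :* t :* (δ :- b) :+ b) :- (b :* b :- 2ₚ :* 2ₚ :* c)) refl (ι b) (ι c) ½ δ ⟩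
      (2# * ½ * (δ - ι b) + ι b) * (2# * ½ * (δ - ι b) + ι b) - (ι b * ι b - 2# * 2# * ι c)
        ≈⟨ +-cong (*-cong 2½[δ-b]+b≈δ 2½[δ-b]+b≈δ) (-‿cong (sym ι-discriminant)) ⟩
      δ * δ - ι discriminant   ≈⟨ x≈y⇒x∙y⁻¹≈ε δ²≈D ⟩
      0#                       ∎))
      where
      α = ½ * (δ - ι b)
      2½[δ-b]+b≈δ : 2# * ½ * (δ - ι b) + ι b ≈ δ
      2½[δ-b]+b≈δ = trans (+-congʳ (*-congʳ 2*½≈1)) (solve 2 (λ δ b → con (+ 1) :* (δ :- b) :+ b := δ) refl δ (ι b))

    root-exists : ∃[ α ] IsRoot α
    root-exists
      with β , β∉F ← ∃-outside 1<q
      with x , y , x+yβ≈β² ← Basis.coordinates β∉F (β * β)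
      = ½ * (δ - ι b) , √discriminant⇒root δ²≈D
      where
      -- Completing the square in β^2 = x + yβ: with γ = 2β - y, the square γ^2 is the discriminant
      -- e = y^2 + 4x, and γ lies outside F because β does.
      γ : Carrier
      γ = 2# * β - ι y
      e : F.Carrier
      e = y F.* y F.+ (F.1# F.+ F.1#) F.* (F.1# F.+ F.1#) F.* x

      γ²≈e : γ * γ ≈ ι e
      γ²≈e = begin
        γ * γ
          ≈⟨ solve 2 (λ β y → (2ₚ :* β :- y) :* (2ₚ :* β :- y) := y :* y :+ 2ₚ :* 2ₚ :* (β :* β :- y :* β)) refl β (ι y) ⟩
        ι y * ι y + 2# * 2# * (β * β - ι y * β)        ≈⟨ +-congˡ (*-congˡ (+-congʳ x+yβ≈β²)) ⟨
        ι y * ι y + 2# * 2# * (ι x + ι y * β - ι y * β)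
          ≈⟨ solve 3 (λ x y z → y :* y :+ 2ₚ :* 2ₚ :* (x :+ z :- z) := y :* y :+ 2ₚ :* 2ₚ :* x) refl (ι x) (ι y) (ι y * β) ⟩
        ι y * ι y + 2# * 2# * ι x
          ≈⟨ +-cong (*-homo y y) (trans (*-homo _ x) (*-congʳ (trans (*-homo _ _) (*-cong ι-2 ι-2)))) ⟨
        ι (y F.* y) + ι ((F.1# F.+ F.1#) F.* (F.1# F.+ F.1#) F.* x)  ≈⟨ +-homo _ _ ⟨
        ι e                                            ∎

      γ∉F : ∀ z → ¬ γ ≈ ι z
      γ∉F z γ≈z = β∉F (halfF F.* (z F.+ y)) (begin
        ι (halfF F.* (z F.+ y))        ≈⟨ trans (*-homo halfF _) (*-congˡ (+-homo z y)) ⟩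
        ½ * (ι z + ι y)                ≈⟨ *-congˡ (+-congʳ γ≈z) ⟨
        ½ * (2# * β - ι y + ι y)
          ≈⟨ solve 3 (λ t β y → t :* (2ₚ :* β :- y :+ y) := 2ₚ :* t :* β) refl ½ β (ι y) ⟩
        2# * ½ * β                     ≈⟨ *-congʳ 2*½≈1 ⟩
        1# * β                         ≈⟨ *-identityˡ β ⟩
        β                              ∎)

      -- A square root of e in F would have to be γ or -γ, since square roots in K are unique up to
      -- sign.
      e-nonsquare : ∀ z → ¬ z F.* z F.≈ e
      e-nonsquare z z²≈e with x²≈y²⇒x≈y⊎x≈-y (trans γ²≈e (trans (sym (⟦⟧-cong z²≈e)) (*-homo z z)))
      ... | inj₁ γ≈z  = γ∉F z γ≈z
      ... | inj₂ γ≈-z = γ∉F (F.- z) (trans γ≈-z (sym (-‿homo z)))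

      γ≉0 : ¬ γ ≈ 0#
      γ≉0 γ≈0 = γ∉F F.0# (trans γ≈0 (sym 0#-homo))

      j k : ℕ
      j = proj₁ (F.nonsquare⇒odd-power c-primitive e-nonsquare)
      k = proj₁ discriminant-odd-power

      γ⁻¹ : Carrier
      γ⁻¹ = proj₁ (inverse γ γ≉0)

      δ : Carrier
      δ = ι c ^ suc (j ℕ.+ k) * γ⁻¹

      -- e D = c^(2j+1) c^(2k+1) is the square of c^(j+k+1), while e = γ².
      δ²≈D : δ * δ ≈ ι discriminant
      δ²≈D = *-cancelˡ γ≉0 (*-cancelˡ γ≉0 (begin
        γ * (γ * (δ * δ))
          ≈⟨ solve 3 (λ γ γ⁻¹ s → γ :* (γ :* (s :* γ⁻¹ :* (s :* γ⁻¹))) := γ :* γ⁻¹ :* (γ :* γ⁻¹) :* (s :* s)) refl γ γ⁻¹ (ι c ^ suc (j ℕ.+ k)) ⟩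
        γ * γ⁻¹ * (γ * γ⁻¹) * (ι c ^ suc (j ℕ.+ k) * ι c ^ suc (j ℕ.+ k))
          ≈⟨ *-cong (*-cong γγ⁻¹≈1 γγ⁻¹≈1) (^-homo-* (ι c) (suc (j ℕ.+ k)) (suc (j ℕ.+ k))) ⟨
        1# * 1# * ι c ^ (suc (j ℕ.+ k) ℕ.+ suc (j ℕ.+ k))
          ≈⟨ trans (*-congʳ (*-identityˡ 1#)) (*-identityˡ _) ⟩
        ι c ^ (suc (j ℕ.+ k) ℕ.+ suc (j ℕ.+ k))
          ≡⟨ ≡.cong (ι c ^_) (identity j k) ⟩
        ι c ^ (suc (j ℕ.+ j) ℕ.+ suc (k ℕ.+ k))
          ≈⟨ ^-homo-* (ι c) (suc (j ℕ.+ j)) (suc (k ℕ.+ k)) ⟩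
        ι c ^ suc (j ℕ.+ j) * ι c ^ suc (k ℕ.+ k)
          ≈⟨ *-cong (ι-^ c (suc (j ℕ.+ j))) (ι-^ c (suc (k ℕ.+ k))) ⟨
        ι (c F.^ suc (j ℕ.+ j)) * ι (c F.^ suc (k ℕ.+ k))
          ≈⟨ *-cong (⟦⟧-cong (proj₂ (F.nonsquare⇒odd-power c-primitive e-nonsquare))) (⟦⟧-cong (proj₂ discriminant-odd-power)) ⟩
        ι e * ι discriminant
          ≈⟨ *-congʳ γ²≈e ⟨
        γ * γ * ι discriminant
          ≈⟨ *-assoc γ γ _ ⟩
        γ * (γ * ι discriminant) ∎))
        where
        γγ⁻¹≈1 : 1# ≈ γ * γ⁻¹
        γγ⁻¹≈1 = sym (proj₂ (inverse γ γ≉0))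
        identity : ∀ j k → suc (j ℕ.+ k) ℕ.+ suc (j ℕ.+ k) ≡ suc (j ℕ.+ j) ℕ.+ suc (k ℕ.+ k)
        identity = ℕSolver.solve-∀

    module Root {α : Carrier} (root : IsRoot α) where

      α≉0 : ¬ α ≈ 0#
      α≉0 α≈0 = root∉F root F.0# (trans 0#-homo (sym α≈0))

      private
        -- The derivative of f at α, a square root of the discriminant because D = f′(α)^2 - 4 f(α).
        δ : Carrier
        δ = 2# * α + ι b

        δ²≈D : δ * δ ≈ ι discriminant
        δ²≈D = begin
          δ * δ
            ≈⟨ solve 3 (λ b c α → (2ₚ :* α :+ b) :* (2ₚ :* α :+ b) := 2ₚ :* (2ₚ :* (c :+ b :* α :+ α :* α)) :+ (b :* b :- 2ₚ :* 2ₚ :* c)) refl (ι b) (ι c) α ⟩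
          2# * (2# * (ι c + ι b * α + α * α)) + (ι b * ι b - 2# * 2# * ι c)
            ≈⟨ +-cong (*-congˡ (*-congˡ root)) (sym ι-discriminant) ⟩
          2# * (2# * 0#) + ι discriminant   ≈⟨ solve 1 (λ d → 2ₚ :* (2ₚ :* con (+ 0)) :+ d := d) refl _ ⟩
          ι discriminant                    ∎

      -- Apply Frobenius to 2α = δ + (-b). It fixes 2 and b, which come from F, and negates δ, so
      -- that 2α^q = -δ - b = 2(-b - α).
      α^q≈conjugate : α ^ q ≈ - ι b - α
      α^q≈conjugate = *-cancelˡ 2≉0 (begin
        2# * α ^ q                   ≈⟨ *-congʳ (trans (sym ι-2) (trans (sym (ι-fixed _)) (^-congˡ q ι-2))) ⟩
        2# ^ q * α ^ q               ≈⟨ ^-distrib-* 2# α q ⟨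
        (2# * α) ^ q
          ≈⟨ ^-congˡ q (trans (solve 2 (λ α b → 2ₚ :* α := (2ₚ :* α :+ b) :+ :- b) refl α (ι b)) (+-congˡ (sym (-‿homo b)))) ⟩
        (δ + ι (F.- b)) ^ q          ≈⟨ ^q-homo-+ δ (ι (F.- b)) ⟩
        δ ^ q + ι (F.- b) ^ q
          ≈⟨ +-cong (√nonsquare^q≈- (proj₁ discriminant-odd-power) (trans δ²≈D (sym (⟦⟧-cong (proj₂ discriminant-odd-power))))) (trans (ι-fixed (F.- b)) (-‿homo b)) ⟩
        - δ + - ι b
          ≈⟨ solve 2 (λ α b → :- (2ₚ :* α :+ b) :+ :- b := 2ₚ :* (:- b :- α)) refl α (ι b) ⟩
        2# * (- ι b - α)             ∎)

      trace : α + α ^ q ≈ - ι b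
      trace = trans (+-congˡ α^q≈conjugate) (solve 2 (λ α b → α :+ (:- b :- α) := :- b) refl α (ι b))

      norm : α ^ suc q ≈ ι c
      norm = begin
        α * α ^ q                        ≈⟨ *-congˡ α^q≈conjugate ⟩
        α * (- ι b - α)
          ≈⟨ solve 3 (λ α b c → α :* (:- b :- α) := c :- (c :+ b :* α :+ α :* α)) refl α (ι b) (ι c) ⟩
        ι c - (ι c + ι b * α + α * α)    ≈⟨ +-congˡ (-‿cong root) ⟩
        ι c - 0#                         ≈⟨ solve 1 (λ c → c :- con (+ 0) := c) refl (ι c) ⟩
        ι c                              ∎

      u : Carrier
      u = α ^ (h ℕ.+ h)

      ιV≈ : ∀ n → ι (V n) ≈ α ^ n * (1# + u ^ n)
      ιV≈ n = begin
        ι (V n)                   ≈⟨ lucas≈sumOfPowers (fieldRing K) trace norm (ι ∘ V) ιV₀ ιV₁ ιV-rec n ⟩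
        -- Once q has the form `suc (h ℕ.+ h)`, the power α^q unfolds to `α * u`.
        α ^ n + (α ^ q) ^ n       ≡⟨ ≡.cong (λ m → α ^ n + (α ^ m) ^ n) q≡1+2h ⟩
        α ^ n + (α * u) ^ n       ≈⟨ +-congˡ (^-distrib-* α u n) ⟩
        α ^ n + α ^ n * u ^ n
          ≈⟨ solve 2 (λ x y → x :+ x :* y := x :* (con (+ 1) :+ y)) refl (α ^ n) (u ^ n) ⟩
        α ^ n * (1# + u ^ n)      ∎
        where
        open BivariateEvaluation (fieldRing F) b c using (eval₂-𝒱-0; eval₂-𝒱-1; eval₂-𝒱-suc-suc)
        ιV₀ : ι (V 0) ≈ 2#
        ιV₀ = trans (⟦⟧-cong eval₂-𝒱-0) ι-2
        ιV₁ : ι (V 1) ≈ - ι b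
        ιV₁ = trans (⟦⟧-cong eval₂-𝒱-1) (-‿homo b)
        ιV-rec : ∀ n → ι (V (suc (suc n))) ≈ (- ι b) * ι (V (suc n)) + - (ι c * ι (V n))
        ιV-rec n = trans (⟦⟧-cong (eval₂-𝒱-suc-suc n)) (trans (+-homo _ _) (+-cong
          (trans (*-homo _ _) (*-congʳ (-‿homo b))) (trans (-‿homo _) (-‿cong (*-homo c (V n))))))

      V≈0⇒uⁿ≈-1 : ∀ n → V n F.≈ F.0# → u ^ n ≈ - 1#
      V≈0⇒uⁿ≈-1 n V≈0 = inverseˡ-unique (u ^ n) 1# (trans (+-comm _ _)
        (xy≈0⇒y≈0 (^-≉0 n α≉0) (trans (sym (ιV≈ n)) (trans (⟦⟧-cong V≈0) 0#-homo))))

      uⁿ≈-1⇒V≈0 : ∀ n → u ^ n ≈ - 1# → V n F.≈ F.0#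
      uⁿ≈-1⇒V≈0 n uⁿ≈-1 = ι≈0⇒≈0 (trans (ιV≈ n) (trans (*-congˡ (trans (+-congˡ uⁿ≈-1) (-‿inverseʳ 1#))) (zeroʳ _)))

      private
        pred[q²]≡2h*[1+q] : pred (q ℕ.^ 2) ≡ (h ℕ.+ h) ℕ.* suc q
        pred[q²]≡2h*[1+q] = ≡.sym (≡.cong pred 1+2h*[1+q]≡q²)

        suc[q]≡2*suc[h] : suc q ≡ 2 ℕ.* suc h
        suc[q]≡2*suc[h] = ≡.trans (≡.cong suc q≡1+2h) (identity h)
          where
          identity : ∀ h → suc (suc (h ℕ.+ h)) ≡ 2 ℕ.* suc h
          identity = ℕSolver.solve-∀

        u^suc[q]≈1 : u ^ suc q ≈ 1#
        u^suc[q]≈1 = begin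
          (α ^ (h ℕ.+ h)) ^ suc q    ≈⟨ ^-comm α (h ℕ.+ h) (suc q) ⟩
          (α ^ suc q) ^ (h ℕ.+ h)    ≈⟨ ^-congˡ (h ℕ.+ h) norm ⟩
          ι c ^ (h ℕ.+ h)            ≈⟨ ι-^ c (h ℕ.+ h) ⟨
          ι (c F.^ (h ℕ.+ h))        ≡⟨ ≡.cong (λ n → ι (c F.^ pred n)) q≡1+2h ⟨
          ι (c F.^ pred q)           ≈⟨ ⟦⟧-cong G.g^pred[n]≈1 ⟩
          ι F.1#                     ≈⟨ 1#-homo ⟩
          1#                         ∎

        -- The exponent (q - 1)(q + 1)/2 regroups as (q + 1) h, which turns the power of α into c^h
        -- by the norm; c is primitive, so c^h = -1.
        u^suc[h]≈-1 : u ^ suc h ≈ - 1#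
        u^suc[h]≈-1 = begin
          (α ^ (h ℕ.+ h)) ^ suc h    ≈⟨ ^-assocʳ α (h ℕ.+ h) (suc h) ⟩
          α ^ ((h ℕ.+ h) ℕ.* suc h)
            ≡⟨ ≡.cong (α ^_) (≡.trans (identity h) (≡.cong (ℕ._* h) (≡.sym (≡.cong suc q≡1+2h)))) ⟩
          α ^ (suc q ℕ.* h)          ≈⟨ ^-assocʳ α (suc q) h ⟨
          (α ^ suc q) ^ h            ≈⟨ ^-congˡ h norm ⟩
          ι c ^ h                    ≈⟨ ιg^h≈-1 ⟩
          - 1#                       ∎
          where
          identity : ∀ h → (h ℕ.+ h) ℕ.* suc h ≡ suc (suc (h ℕ.+ h)) ℕ.* h
          identity = ℕSolver.solve-∀

      primitive⇒V≉0 : PrimitiveElement K α → ∀ n p → 1 < p → n ℕ.* (2 ℕ.* p) ≡ suc q → ¬ V n F.≈ F.0#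
      primitive⇒V≉0 α-primitive n p 1<p n*2p≡suc[q] V≈0 =
        ℕ.<⇒≱ (ℕ.m<m*n t p {{ℕ.>-nonZero 0<t}} 1<p)
          (≡.subst (_≤ t) pred[q²]≡t*p (A.gᵗ≈1⇒pred[n]≤t t 0<t αᵗ≈1))
        where
        module A = Generator α-primitive
        -- As 2n = N/p, this is (q - 1) N/p = (q^2 - 1)/p, which `1 < p` makes smaller than the
        -- order of a generator of K.
        t : ℕ
        t = (h ℕ.+ h) ℕ.* (n ℕ.+ n)

        pred[q²]≡t*p : pred (q ℕ.^ 2) ≡ t ℕ.* p
        pred[q²]≡t*p = ≡.trans pred[q²]≡2h*[1+q] (≡.trans (≡.cong ((h ℕ.+ h) ℕ.*_) (≡.sym n*2p≡suc[q])) (identity h n p))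
          where
          identity : ∀ h n p → (h ℕ.+ h) ℕ.* (n ℕ.* (2 ℕ.* p)) ≡ (h ℕ.+ h) ℕ.* (n ℕ.+ n) ℕ.* p
          identity = ℕSolver.solve-∀

        0<t : 0 < t
        0<t = ℕ.n≢0⇒n>0 λ t≡0 → ℕ.<⇒≢ A.0<pred[n] (≡.sym (≡.trans pred[q²]≡t*p (≡.cong (ℕ._* p) t≡0)))

        αᵗ≈1 : α ^ t ≈ 1#
        αᵗ≈1 = begin
          α ^ ((h ℕ.+ h) ℕ.* (n ℕ.+ n))   ≈⟨ ^-assocʳ α (h ℕ.+ h) (n ℕ.+ n) ⟨
          u ^ (n ℕ.+ n)                   ≈⟨ ^-homo-* u n n ⟩
          u ^ n * u ^ n                   ≈⟨ *-cong (V≈0⇒uⁿ≈-1 n V≈0) (V≈0⇒uⁿ≈-1 n V≈0) ⟩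
          - 1# * - 1#                     ≈⟨ solve 0 ((:- con (+ 1)) :* (:- con (+ 1)) := con (+ 1)) refl ⟩
          1#                              ∎

      module _ (fac : EvenFactorisation (suc q)) where

        open EvenFactorisation fac
        open EvenFactorisationProperties fac

        V≉0⇒primitive : (∀ i → ¬ V (N/2p i) F.≈ F.0#) → PrimitiveElement K α
        V≉0⇒primitive V≉0 = faithful-powers⇒primitive α≉0 faithful
          where
          -- Otherwise u^(N/2) would be 1 and not -1. This serves twice: with d dividing N/2 for the
          -- prime 2, and with d = N/2p for an odd prime p, as N/2p divides N/2.
          u^[d∣suc[h]]≉1 : ∀ {d} → d ∣ suc h → ¬ u ^ d ≈ 1#
          u^[d∣suc[h]]≉1 d∣suc[h] uᵈ≈1 = -1≉1 (trans (sym u^suc[h]≈-1) (^-∣-≈1 d∣suc[h] uᵈ≈1))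

          n∣suc[h] : ∀ i → N/2p i ∣ suc h
          n∣suc[h] i = divides (p i) (ℕ.*-cancelˡ-≡ (suc h) (p i ℕ.* N/2p i) 2
            (≡.trans (≡.sym suc[q]≡2*suc[h]) (≡.trans (≡.sym (N/2p*2p≡N i)) (identity (N/2p i) (p i)))))
            where
            identity : ∀ n p → n ℕ.* (2 ℕ.* p) ≡ 2 ℕ.* (p ℕ.* n)
            identity = ℕSolver.solve-∀

          p*d∣N⇒d∣n+n : ∀ i {d} → p i ℕ.* d ∣ suc q → d ∣ N/2p i ℕ.+ N/2p i
          p*d∣N⇒d∣n+n i {d} p*d∣N = *-cancelˡ-∣ (p i) {{prime⇒nonZero (p-prime i)}}
            (≡.subst (p i ℕ.* d ∣_) (≡.trans (≡.sym (N/2p*2p≡N i)) (identity (N/2p i) (p i))) p*d∣N)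
            where
            identity : ∀ n p → n ℕ.* (2 ℕ.* p) ≡ p ℕ.* (n ℕ.+ n)
            identity = ℕSolver.solve-∀

          u^[n+n]≉1 : ∀ i → ¬ u ^ (N/2p i ℕ.+ N/2p i) ≈ 1#
          u^[n+n]≉1 i u^[n+n]≈1 = refute (x²≈y²⇒x≈y⊎x≈-y
            (trans (sym (^-homo-* u (N/2p i) (N/2p i))) (trans u^[n+n]≈1 (sym (*-identityˡ 1#)))))
            where
            refute : ¬ (u ^ N/2p i ≈ 1# ⊎ u ^ N/2p i ≈ - 1#)
            refute (inj₁ uⁿ≈1)  = u^[d∣suc[h]]≉1 (n∣suc[h] i) uⁿ≈1
            refute (inj₂ uⁿ≈-1) = V≉0 i (uⁿ≈-1⇒V≈0 (N/2p i) uⁿ≈-1)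

          u^[N/r]≉1 : ∀ {r d} → r ℕ.* d ∣ suc q → r ≡ 2 ⊎ (∃[ i ] r ≡ p i) → ¬ u ^ d ≈ 1#
          u^[N/r]≉1 {d = d} 2*d∣N (inj₁ ≡.refl) =
            u^[d∣suc[h]]≉1 {d} (*-cancelˡ-∣ 2 (≡.subst (2 ℕ.* d ∣_) suc[q]≡2*suc[h] 2*d∣N))
          u^[N/r]≉1 p*d∣N (inj₂ (i , ≡.refl)) uᵈ≈1 =
            u^[n+n]≉1 i (^-∣-≈1 (p*d∣N⇒d∣n+n i p*d∣N) uᵈ≈1)

          u^properDivisor≉1 : ∀ {d} → d ∣ suc q → d < suc q → ¬ u ^ d ≈ 1#
          u^properDivisor≉1 {d} d∣N d<N = let r , r-prime , r*d∣N = properDivisor-prime-multiple d∣N d<N in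
            u^[N/r]≉1 r*d∣N (primeDivisor-cases r-prime (∣-trans (m∣m*n d) r*d∣N))

          faithful : ∀ t → 0 < t → t < pred (q ℕ.^ 2) → ¬ α ^ t ≈ 1#
          faithful t 0<t t<q²-1 αᵗ≈1 = refute (G.gᵗ≈1⇒pred[n]∣t t (ι-injective (begin
              ι (c F.^ t)         ≈⟨ ι-^ c t ⟩
              ι c ^ t             ≈⟨ ^-congˡ t norm ⟨
              (α ^ suc q) ^ t     ≈⟨ ^-comm α (suc q) t ⟩
              (α ^ t) ^ suc q     ≈⟨ ^-congˡ (suc q) αᵗ≈1 ⟩
              1# ^ suc q          ≈⟨ 1^n≈1 (suc q) ⟩
              1#                  ≈⟨ 1#-homo ⟨
              ι F.1#              ∎)))
            where
            refute : ¬ pred q ∣ t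
            -- From t < (q - 1) N follows 0 < k < N, so gcd(k, N) is a proper divisor of N, and by
            -- Bézout an exponent at which u becomes 1.
            refute (divides k t≡k*pred[q]) = u^properDivisor≉1 (gcd[m,n]∣n k (suc q))
              (ℕ.≤-<-trans (∣⇒≤ {{ℕ.>-nonZero 0<k}} (gcd[m,n]∣m k (suc q))) k<suc[q])
              (^-gcd-≈1 k (suc q) uᵏ≈1 u^suc[q]≈1)
              where
              t≡2h*k : t ≡ (h ℕ.+ h) ℕ.* k
              t≡2h*k = ≡.trans t≡k*pred[q] (≡.trans (≡.cong (k ℕ.*_) (≡.cong pred q≡1+2h)) (ℕ.*-comm k (h ℕ.+ h)))
              0<k : 0 < k
              0<k = ℕ.n≢0⇒n>0 λ k≡0 → ℕ.<⇒≢ 0<t (≡.sym (≡.trans t≡k*pred[q] (≡.cong (ℕ._* pred q) k≡0)))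
              k<suc[q] : k < suc q
              k<suc[q] = ℕ.*-cancelˡ-< (h ℕ.+ h) k (suc q) (≡.subst₂ _<_ t≡2h*k pred[q²]≡2h*[1+q] t<q²-1)
              uᵏ≈1 : u ^ k ≈ 1#
              uᵏ≈1 = trans (^-assocʳ α (h ℕ.+ h) k) (trans (sym (^-congʳ α t≡2h*k)) αᵗ≈1)

      isMinimalPolynomial : IsMinimalPolynomial F K ι (quadratic F b c) α
      isMinimalPolynomial = record
        { degree  = 2
        ; monic   = F.refl , λ { (suc (suc (suc n))) _ → F.refl ; 1 (s≤s ()) ; 2 (s≤s (s≤s ())) }
        ; root    = trans (eval≈ α) root
        ; minimal = minimal
        }
        where
        open IsRingHomomorphism (Evaluation.eval-isRingHomomorphism (fieldRing F) (fieldRing K) ι-hom α)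
          using () renaming (⟦⟧-cong to eval-cong)
        ev : List F.Carrier → Carrier
        ev g = eval raw ι g α

        -- `g` may carry trailing zeros, so it is first replaced by the short list with the same
        -- coefficients. In degree 0 it is the constant 1, which has no root; in degree 1 a root α =
        -- -x would lie in F.
        minimal : ∀ {d} g → MonicOfDegree (rawRing F) d g → ev g ≈ 0# → 2 ≤ d
        minimal {0} g (lead , rest) g[α]≈0 = contradiction (begin
          1#                       ≈⟨ 1#-homo ⟨
          ι F.1#                   ≈⟨ solve 2 (λ x α → x := x :+ α :* con (+ 0)) refl (ι F.1#) α ⟩
          ev (F.1# ∷ [])
            ≈⟨ eval-cong {g} {F.1# ∷ []} (λ { 0 → lead ; (suc n) → rest (suc n) z<s }) ⟨
          ev g                     ≈⟨ g[α]≈0 ⟩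
          0#                       ∎) 1≉0
        minimal {1} g (lead , rest) g[α]≈0 = contradiction (begin
          ι (F.- x)                          ≈⟨ -‿homo x ⟩
          - ι x
            ≈⟨ solve 2 (λ x α → :- x := α :- (x :+ α :* (con (+ 1) :+ α :* con (+ 0)))) refl (ι x) α ⟩
          α - (ι x + α * (1# + α * 0#))      ≈⟨ +-congˡ (-‿cong (+-congˡ (*-congˡ (+-congʳ 1#-homo)))) ⟨
          α - ev (x ∷ F.1# ∷ [])
            ≈⟨ +-congˡ (-‿cong (eval-cong {g} {x ∷ F.1# ∷ []} (λ { 0 → F.refl ; 1 → lead ; (suc (suc n)) → rest (suc (suc n)) (s<s z<s) }))) ⟨
          α - ev g                           ≈⟨ +-congˡ (-‿cong g[α]≈0) ⟩
          α - 0#                             ≈⟨ solve 1 (λ α → α :- con (+ 0) := α) refl α ⟩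
          α                                  ∎) (root∉F root (F.- x))
          where
          x : F.Carrier
          x = coeff (rawRing F) g 0
        minimal {suc (suc d)} g _ _ = s≤s (s≤s ℕ.z≤n)

-- Primitivity of f and the value of E

open import Data.Nat.Base using (_^_)

proposition5p6 : ∀ {c ℓ₁ ℓ₂ c′ ℓ₁′ ℓ₂′ : Level} {q : ℕ} → OddPrimePower q →
    (F : HeytingField c ℓ₁ ℓ₂) → HasOrder F q →
    (K : HeytingField c′ ℓ₁′ ℓ₂′) → HasOrder K (q ^ 2) →
    (ι : HeytingField.Carrier F → HeytingField.Carrier K) →
    IsRingHomomorphism (rawRing F) (rawRing K) ι →
    (fac : EvenFactorisation (suc q)) →
    ∀ E → IsE (rawRing F) fac E →
    ∀ b c → IrreduciblePoly F (quadratic F b c) → PrimitiveElement F c →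
    PrimitiveQuadratic F K ι (quadratic F b c) ⇔
    (¬ (HeytingField._≈_ F (eval₂ (rawRing F) E b c) (HeytingField.0# F)))
proposition5p6 q-power F F-order K K-order ι ι-hom fac E isE b c irreducible c-primitive =
  mk⇔ primitive⇒E≉0 E≉0⇒primitive
  where
  open EvenFactorisation fac
  open EvenFactorisationProperties fac
  open FiniteField F F-order using (1≉0; xy≈0⇒x≈0⊎y≈0)
  open IsE isE using (isLCM)

  -- The factor 2^m with m > 0 makes q + 1 even, which provides the h with q = 2h + 1.
  q-odd = even-suc⇒odd 2∣N
  open QuadraticExtension F F-order K K-order ι ι-hom q-power (proj₁ q-odd) (proj₂ q-odd)
  open Quadratic irreducible c-primitive

  primitive⇒E≉0 : PrimitiveQuadratic F K ι (quadratic F b c) → ¬ F._≈_ (eval₂ (rawRing F) E b c) F.0#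
  primitive⇒E≉0 (α , α-primitive , isMinimal) =
    eval₂-lcm≉0⇐ (fieldRing F) 1≉0 xy≈0⇒x≈0⊎y≈0 b c isLCM λ i →
      Root.primitive⇒V≉0 α-root α-primitive (N/2p i) (p i)
        (ℕ.nonTrivial⇒n>1 (p i) {{prime⇒nonTrivial (p-prime i)}}) (N/2p*2p≡N i)
    where
    α-root : IsRoot α
    α-root = HeytingField.trans K (HeytingField.sym K (eval≈ α)) (IsMinimalPolynomial.root isMinimal)

  -- A nonzero value of E makes every root of f in K a generator, so the root found by `root-exists`
  -- serves.
  E≉0⇒primitive : ¬ F._≈_ (eval₂ (rawRing F) E b c) F.0# → PrimitiveQuadratic F K ι (quadratic F b c)
  E≉0⇒primitive E≉0 =
    let α , α-root = root-exists in
    α , Root.V≉0⇒primitive α-root fac (eval₂-lcm≉0⇒ (fieldRing F) 1≉0 xy≈0⇒x≈0⊎y≈0 b c isLCM E≉0)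
      , Root.isMinimalPolynomial α-root
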